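{- For every integer $n\ge 1$, $$MD_n \sim HMD_{n-1}\ \dot{\cup}\ HMD_{n-1}\ \dot{\cup}\ R_n\ \dot{\cup}\ R'_n.$$
   Context: The adjacency matrix of a weighted graph has rows and columns indexed by the vertices, its $(u,v)$-entry being the weight of the edge between $u$ and $v$ if there is one, and $0$ otherwise (a loop of weight $c$ at $u$ contributes the diagonal entry $c$); unweighted graphs have all weights $1$. Two graphs are called similar, written $G_1\sim G_2$, if their adjacency matrices are similar matrices. $\dot\cup$ denotes disjoint union. The mixed Aztec diamond $MD_n$ is the graph whose vertices are the black unit squares of a $2n\times 2n$ chessboard, two vertices being adjacent if the corresponding squares share a corner. The halved mixed Aztec diamond $HMD_n$ is the subgraph of $MD_n$ induced by the black squares on or above the black diagonal of the $2n\times 2n$ board (the main diagonal consisting of black squares); $HMD_0$ is the empty graph. $P_n$ is the path on $n$ vertices (edge weights $1$). $Q_n$ is the graph obtained from $P_n$ by including a loop of weight $2$ at each vertex, and $Q'_n$ is obtained from $P_n$ by including a loop of weight $-2$ at each vertex. $R_n$ is obtained from $Q_n$ by changing the weight of the loop at the last vertex of the path to $1$, and $R'_n$ is obtained from $Q'_n$ by changing the weight of the loop at the last vertex to $-1$. -}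

module Defs where

open import Data.Bool.Base using (if_then_else_)
open import Data.Empty using (⊥-elim)
open import Data.Fin.Base using (Fin; zero; suc; toℕ)
open import Data.Fin.Properties using (*↔×; +↔⊎)
import Data.Fin.Properties as Fin
open import Data.Irrelevant using ([_])
open import Data.Maybe.Base using (Maybe; just; nothing; fromMaybe)
open import Data.Nat.Base using (ℕ; zero; suc; _+_; _*_; _≤_; ∣_-_∣)
open import Data.Nat.Divisibility using (_∣_; _∣?_)
open import Data.Nat.Properties using (_≟_; _≤?_; ∣-∣-comm)
open import Data.Product.Base using (_×_; _,_; Σ-syntax; ∃; proj₁; proj₂)
open import Data.Rational.Base as ℚ using (ℚ; 0ℚ; 1ℚ)
open import Data.Rational.Literals using (fromℤ)
open import Data.Rational.Properties using (+-0-monoid)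
open import Data.Integer.Base using (+_; -_)
open import Data.Refinement.Base using (Refinement-syntax; value; _,_)
open import Data.Sum.Base using (_⊎_; inj₁; inj₂)
open import Data.Product.Function.NonDependent.Propositional using (_×-↔_)
open import Data.Sum.Function.Propositional using (_⊎-↔_)
open import Function.Base using (_on_)
open import Function.Bundles using (_↔_; Inverse; mk↔ₛ′)
open import Function.Construct.Composition using (_↔-∘_)
open import Function.Construct.Identity using (↔-id)
open import Function.Construct.Symmetry using (↔-sym)
open import Function.Properties.Inverse using (↔⇒↣)
open import Level using (0ℓ)
open import Relation.Binary.Core using (Rel)
open import Relation.Binary.Definitions using (DecidableEquality; Symmetric)
  renaming (Decidable to Decidable₂)
open import Relation.Binary.PropositionalEquality using (_≡_; refl; sym; trans; subst)
open import Relation.Nullary.Decidable using (Dec; yes; no; does; _×-dec_; recompute; via-injection)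
open import Relation.Unary using (Pred; Decidable)
open import Relation.Unary.Properties using (U?)
open import Algebra.Properties.Monoid.Sum +-0-monoid using (sum)

------------------------------------------------------------------------
-- Finite sets

record FinSet : Set₁ where
  field
    Carrier : Set
    size    : ℕ
    enum    : Fin size ↔ Carrier

  infix 4 _≟ᶜ_
  _≟ᶜ_ : DecidableEquality Carrier
  _≟ᶜ_ = via-injection (↔⇒↣ (↔-sym enum)) Fin._≟_

open FinSet using (Carrier)

⟦Fin_⟧ : ℕ → FinSet
⟦Fin n ⟧ = record { Carrier = Fin n ; size = n ; enum = ↔-id (Fin n) }

infixr 2 _⊗_
_⊗_ : FinSet → FinSet → FinSet
V ⊗ W = record
  { Carrier = Carrier V × Carrier W
  ; size    = FinSet.size V * FinSet.size W
  ; enum    = (FinSet.enum V ×-↔ FinSet.enum W) ↔-∘ *↔×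
  }

infixr 1 _⊕_
_⊕_ : FinSet → FinSet → FinSet
V ⊕ W = record
  { Carrier = Carrier V ⊎ Carrier W
  ; size    = FinSet.size V + FinSet.size W
  ; enum    = (FinSet.enum V ⊎-↔ FinSet.enum W) ↔-∘ +↔⊎
  }

count : ∀ {n} {P : Pred (Fin n) 0ℓ} → Decidable P → ∃ λ k → Fin k ↔ [ i ∈ Fin n ∣ P i ]
count {zero}  P? = 0 , mk↔ₛ′ (λ ()) (λ { (() , _) }) (λ { (() , _) }) (λ ())
count {suc n} {P} P? with P? zero | count (λ i → P? (suc i))
... | no ¬p | k , e = k , mk↔ₛ′ f g f-g strictlyInverseʳ
  where
  open Inverse e
  f : Fin k → [ i ∈ Fin (suc n) ∣ P i ]
  f j = let (i , p) = to j in suc i , p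
  g : [ i ∈ Fin (suc n) ∣ P i ] → Fin k
  g (zero  , [ p ]) = ⊥-elim (¬p (recompute (P? zero) p))
  g (suc i , p)     = from (i , p)
  f-g : ∀ x → f (g x) ≡ x
  f-g (zero  , [ p ]) = ⊥-elim (¬p (recompute (P? zero) p))
  f-g (suc i , p) rewrite strictlyInverseˡ (i , p) = refl
... | yes p₀ | k , e = suc k , mk↔ₛ′ f g f-g g-f
  where
  open Inverse e
  f : Fin (suc k) → [ i ∈ Fin (suc n) ∣ P i ]
  f zero    = zero , [ p₀ ]
  f (suc j) = let (i , p) = to j in suc i , p
  g : [ i ∈ Fin (suc n) ∣ P i ] → Fin (suc k)
  g (zero  , _) = zero
  g (suc i , p) = suc (from (i , p))
  f-g : ∀ x → f (g x) ≡ x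
  f-g (zero  , _) = refl
  f-g (suc i , p) rewrite strictlyInverseˡ (i , p) = refl
  g-f : ∀ j → g (f j) ≡ j
  g-f zero    = refl
  g-f (suc j) rewrite strictlyInverseʳ j = refl

transport : ∀ {A B : Set} {P : Pred B 0ℓ} (e : A ↔ B) →
            [ a ∈ A ∣ P (Inverse.to e a) ] ↔ [ b ∈ B ∣ P b ]
transport {A} {B} {P} e = mk↔ₛ′ f g (λ { (b , p) → ≡-value (strictlyInverseˡ b) })
                                    (λ { (a , p) → ≡-value (strictlyInverseʳ a) })
  where
  open Inverse e
  ≡-value : ∀ {C : Set} {Q : Pred C 0ℓ} {x y : [ c ∈ C ∣ Q c ]} → value x ≡ value y → x ≡ y
  ≡-value refl = refl
  f : [ a ∈ A ∣ P (to a) ] → [ b ∈ B ∣ P b ]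
  f (a , p) = to a , p
  g : [ b ∈ B ∣ P b ] → [ a ∈ A ∣ P (to a) ]
  g (b , [ p ]) = from b , [ subst P (sym (strictlyInverseˡ b)) p ]

subset : (V : FinSet) {P : Pred (Carrier V) 0ℓ} → Decidable P → FinSet
subset V {P} P? = record
  { Carrier = [ v ∈ Carrier V ∣ P v ]
  ; size    = proj₁ (count (λ i → P? (Inverse.to enum i)))
  ; enum    = transport {P = P} enum ↔-∘ proj₂ (count (λ i → P? (Inverse.to enum i)))
  }
  where open FinSet V using (enum)

------------------------------------------------------------------------
-- Matrices with rows and columns indexed by finite sets

Matrix : FinSet → FinSet → Set
Matrix V W = Carrier V → Carrier W → ℚ

∑ : (V : FinSet) → (Carrier V → ℚ) → ℚ
∑ V f = sum (λ i → f (Inverse.to (FinSet.enum V) i))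

product : ∀ U V W → Matrix U V → Matrix V W → Matrix U W
product U V W A B u w = ∑ V λ v → A u v ℚ.* B v w

𝟙 : ∀ V → Matrix V V
𝟙 V u v = if does (u ≟ᶜ v) then 1ℚ else 0ℚ
  where open FinSet V using (_≟ᶜ_)

infix 4 _≐_
_≐_ : {X Y : Set} → (X → Y → ℚ) → (X → Y → ℚ) → Set
A ≐ B = ∀ x y → A x y ≡ B x y

-- The two index sets may differ. A two-sided inverse forces them to have the
-- same size, so this is ordinary similarity of square matrices once both sets
-- are listed in any order. Similarity of rational matrices does not change
-- when the field is enlarged, so using ℚ in place of ℝ or ℂ loses nothing.
Similar : ∀ V W → Matrix V V → Matrix W W → Set
Similar V W A B =
  Σ[ P ∈ Matrix V W ] Σ[ P⁻¹ ∈ Matrix W V ]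
    product V W V P P⁻¹ ≐ 𝟙 V ×
    product W V W P⁻¹ P ≐ 𝟙 W ×
    product W V W (product W V V P⁻¹ A) P ≐ B

------------------------------------------------------------------------
-- Weighted graphs

-- edge u v is the weight of the edge between u and v, or nothing if there is
-- none; edge u u is the loop at u.
record Graph : Set₁ where
  field
    vertices : FinSet
    edge     : Carrier vertices → Carrier vertices → Maybe ℚ
    edge-sym : ∀ u v → edge u v ≡ edge v u

  Vertex : Set
  Vertex = Carrier vertices

  open FinSet vertices public using () renaming (_≟ᶜ_ to _≟ᵛ_)

adjacency : (G : Graph) → Matrix (Graph.vertices G) (Graph.vertices G)
adjacency G u v = fromMaybe 0ℚ (Graph.edge G u v)

infix 4 _∼_
_∼_ : Graph → Graph → Set
G ∼ H = Similar (Graph.vertices G) (Graph.vertices H) (adjacency G) (adjacency H)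

infixl 6 _∪̇_
_∪̇_ : Graph → Graph → Graph
G ∪̇ H = record
  { vertices = G.vertices ⊕ H.vertices
  ; edge     = e
  ; edge-sym = λ
      { (inj₁ u) (inj₁ v) → G.edge-sym u v
      ; (inj₁ _) (inj₂ _) → refl
      ; (inj₂ _) (inj₁ _) → refl
      ; (inj₂ u) (inj₂ v) → H.edge-sym u v
      }
  }
  where
  module G = Graph G
  module H = Graph H
  e : G.Vertex ⊎ H.Vertex → G.Vertex ⊎ H.Vertex → Maybe ℚ
  e (inj₁ u) (inj₁ v) = G.edge u v
  e (inj₂ u) (inj₂ v) = H.edge u v
  e _        _        = nothing

induced : (G : Graph) {P : Pred (Graph.Vertex G) 0ℓ} → Decidable P → Graph
induced G P? = record
  { vertices = subset vertices P?
  ; edge     = edge on value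
  ; edge-sym = λ u v → edge-sym (value u) (value v)
  }
  where open Graph G

if-cong-⇔ : ∀ {A B C : Set} (a? : Dec A) (b? : Dec B) {x y y′ : C} →
            (A → B) → (B → A) → y ≡ y′ →
            (if does a? then x else y) ≡ (if does b? then x else y′)
if-cong-⇔ (yes _) (yes _) _   _   _  = refl
if-cong-⇔ (yes a) (no ¬b) a→b _   _  = ⊥-elim (¬b (a→b a))
if-cong-⇔ (no ¬a) (yes b) _   b→a _  = ⊥-elim (¬a (b→a b))
if-cong-⇔ (no _)  (no _)  _   _   eq = eq

unweighted : (V : FinSet) {Adj : Rel (Carrier V) 0ℓ} →
             Decidable₂ Adj → Symmetric Adj → Graph
unweighted V adj? adj-sym = record
  { vertices = V
  ; edge     = λ u v → if does (adj? u v) then just 1ℚ else nothing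
  ; edge-sym = λ u v → if-cong-⇔ (adj? u v) (adj? v u) adj-sym adj-sym refl
  }

-- Give every vertex satisfying P a loop of weight c, replacing any loop
-- already there.
setLoops : (G : Graph) {P : Pred (Graph.Vertex G) 0ℓ} → Decidable P → ℚ → Graph
setLoops G P? c = record
  { vertices = vertices
  ; edge     = λ u v → if does ((u ≟ᵛ v) ×-dec P? u) then just c else edge u v
  ; edge-sym = λ u v → if-cong-⇔ ((u ≟ᵛ v) ×-dec P? u) ((v ≟ᵛ u) ×-dec P? v)
      (λ { (refl , p) → refl , p }) (λ { (refl , p) → refl , p }) (edge-sym u v)
  }
  where open Graph G

------------------------------------------------------------------------
-- Mixed Aztec diamonds

-- Squares are (row , column), rows counted from the top and columns from the left.
row col : ∀ {m} → Fin m × Fin m → ℕ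
row (i , _) = toℕ i
col (_ , j) = toℕ j

-- The colouring in which the main diagonal row = col is black.
Black : ∀ {m} → Pred (Fin m × Fin m) 0ℓ
Black s = 2 ∣ row s + col s

black? : ∀ {m} → Decidable (Black {m})
black? s = 2 ∣? (row s + col s)

blackSquares : ℕ → FinSet
blackSquares m = subset (⟦Fin m ⟧ ⊗ ⟦Fin m ⟧) black?

-- Distinct squares of the same colour never share a side, so they share a
-- corner exactly when they are diagonal neighbours.
ShareCorner : ∀ {m} → Rel (Carrier (blackSquares m)) 0ℓ
ShareCorner (s , _) (t , _) = ∣ row s - row t ∣ ≡ 1 × ∣ col s - col t ∣ ≡ 1

shareCorner? : ∀ {m} → Decidable₂ (ShareCorner {m})
shareCorner? (s , _) (t , _) = (∣ row s - row t ∣ ≟ 1) ×-dec (∣ col s - col t ∣ ≟ 1)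

shareCorner-sym : ∀ {m} → Symmetric (ShareCorner {m})
shareCorner-sym {_} {s , _} {t , _} (p , q) =
  trans (∣-∣-comm (row t) (row s)) p , trans (∣-∣-comm (col t) (col s)) q

MD : ℕ → Graph
MD n = unweighted (blackSquares (2 * n)) shareCorner? (λ {s} {t} → shareCorner-sym {x = s} {t})

OnOrAboveDiagonal : ∀ {n} → Pred (Graph.Vertex (MD n)) 0ℓ
OnOrAboveDiagonal (s , _) = row s ≤ col s

onOrAboveDiagonal? : ∀ {n} → Decidable (OnOrAboveDiagonal {n})
onOrAboveDiagonal? (s , _) = row s ≤? col s

HMD : ℕ → Graph
HMD n = induced (MD n) (onOrAboveDiagonal? {n})

------------------------------------------------------------------------
-- Paths with loops

Consecutive : ∀ {n} → Rel (Fin n) 0ℓ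
Consecutive i j = ∣ toℕ i - toℕ j ∣ ≡ 1

Path : ℕ → Graph
Path n = unweighted ⟦Fin n ⟧ {Consecutive}
  (λ i j → ∣ toℕ i - toℕ j ∣ ≟ 1)
  (λ {i} {j} p → trans (∣-∣-comm (toℕ j) (toℕ i)) p)

IsLast : ∀ {n} → Pred (Fin n) 0ℓ
IsLast {n} i = suc (toℕ i) ≡ n

isLast? : ∀ {n} → Decidable (IsLast {n})
isLast? {n} i = suc (toℕ i) ≟ n

Q Q′ R R′ : ℕ → Graph
Q  n = setLoops (Path n) U? (fromℤ (+ 2))
Q′ n = setLoops (Path n) U? (fromℤ (- + 2))
R  n = setLoops (Q n) isLast? 1ℚ
R′ n = setLoops (Q′ n) isLast? (ℚ.- 1ℚ)

{-# OPTIONS --safe #-}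

-- Let m = 2n and let P be the adjacency matrix of the path on m vertices. A
-- vector on the black squares is an m × m matrix X supported on even i + j, and
-- MD_n acts on it by X ↦ P X P. This commutes with transposition. The antisymmetric
-- X, read off above the diagonal, form HMD_{n-1}. The map K X = P² X - X P²
-- commutes with the action and exchanges antisymmetric and symmetric matrices;
-- it embeds the antisymmetric ones into the symmetric ones, which gives the
-- second copy of HMD_{n-1}. The orthogonal complement of the image is spanned by
-- the even polynomials p in P, on which the action is p ↦ P² p, and by the D p
-- with D = diag((-1)^i), on which it is D p ↦ - D P² p. In the basis of Chebyshev
-- polynomials U_{2(n-1)}, …, U_2, U_0 these are R_n and, after a change of
-- signs, R'_n. The resulting intertwiner T is invertible because T and its
-- transpose are injective, which follows from positivity of the inner product.
module Submission where

open import Defs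
open import Algebra.Bundles using (CommutativeMonoid; CommutativeRing)
open import Data.Bool.Base using (if_then_else_)
open import Data.Empty using (⊥-elim)
open import Data.Fin.Base using (Fin; zero; suc; toℕ; fromℕ<)
import Data.Fin.Properties as Fin
import Data.Integer.Base as ℤ
open import Data.Irrelevant using ([_])
open import Data.Maybe.Base using (just; nothing; fromMaybe)
open import Data.Nat.Base as ℕ using (ℕ; zero; suc; _≤_; _<_; _∸_; ∣_-_∣; z≤n; s≤s)
open import Data.Nat.Divisibility using (_∣_; divides; _∣?_; ∣m∣n⇒∣m+n; ∣m+n∣m⇒∣n; ∣-refl)
import Data.Nat.Properties as ℕ
open import Data.Product.Base using (_×_; _,_; ∃; Σ-syntax; proj₁; proj₂)
open import Data.Rational.Base as ℚ using (ℚ; 0ℚ; 1ℚ; _+_; _*_; -_; _-_)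
open import Data.Rational.Literals using (fromℤ)
open import Data.Rational.Properties as ℚ using (+-*-commutativeRing)
open import Data.Refinement.Base using (value; _,_)
open import Data.Sum.Base using (_⊎_; inj₁; inj₂)
open import Data.Sum.Properties using (inj₁-injective; inj₂-injective)
open import Function.Base using (_∘_)
open import Function.Bundles using (Inverse)
open import Level using (0ℓ)
open import Relation.Binary.Definitions using (Tri; tri<; tri≈; tri>)
open import Relation.Binary.PropositionalEquality
open import Relation.Nullary using (Dec; yes; no; does; ¬_; ¬?)
open import Relation.Nullary.Decidable using (_×-dec_; dec⇒maybe; recompute)
open import Relation.Unary using (Pred; Decidable)
open import Relation.Unary.Properties using (U?)
open import Tactic.RingSolver using (solve-∀)
open import Tactic.RingSolver.Core.AlmostCommutativeRing using (AlmostCommutativeRing; fromCommutativeRing)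
open import Algebra.Properties.CommutativeSemigroup (CommutativeMonoid.commutativeSemigroup ℚ.*-1-commutativeMonoid)
  using () renaming (x∙yz≈y∙xz to *-left-comm)
open import Algebra.Properties.Group ℚ.+-0-group using () renaming (x∙y⁻¹≈ε⇒x≈y to a-b≡0⇒a≡b)
open import Algebra.Properties.Ring (CommutativeRing.ring +-*-commutativeRing)
  using () renaming (-‿involutive to neg-neg; -1*x≈-x to -1*)
open import Algebra.Properties.Semiring.Sum (CommutativeRing.semiring +-*-commutativeRing)
  using (sum-cong-≗; sum-replicate-zero; ∑-distrib-+; ∑-comm; *-distribˡ-sum)

open FinSet using (Carrier; size; enum)

-- The construction is guided by the spectrum of P, whose eigenvalues are in general irrational and
-- so never appear over ℚ. On all m × m grids the products of eigenvectors v_a v_bᵀ diagonalise both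
-- X ↦ P X P and `K`, with eigenvalues λ_a λ_b and λ_a² - λ_b². The λ_a are distinct and symmetric
-- about 0, and D exchanges the eigenvectors for λ and -λ up to a scalar; so the kernel of `K`
-- consists of the sums p(P) + D q(P). The square in `K` is forced by the colouring: P X - X P would
-- move grids from black to white squares. Two devices replace the eigenvectors. The equation P² X =
-- X P² is a recursion along columns, which leaves only the first two columns free, and the first
-- column of `U k` is the k-th unit vector. Positivity replaces every count of dimensions. The even
-- size of the board matters for independence: if 0 were an eigenvalue of P, the projection onto its
-- eigenvector would be both a p(P) and, up to sign, a D p(P).

ℚ-ring : AlmostCommutativeRing _ _
ℚ-ring = fromCommutativeRing +-*-commutativeRing (λ x → dec⇒maybe (0ℚ ℚ.≟ x))

iverson : ∀ {A : Set} → Dec A → ℚ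
iverson d = if does d then 1ℚ else 0ℚ

iverson-yes : ∀ {A : Set} (d : Dec A) → A → iverson d ≡ 1ℚ
iverson-yes (yes _) _ = refl
iverson-yes (no ¬a) a = ⊥-elim (¬a a)

iverson-no : ∀ {A : Set} (d : Dec A) → ¬ A → iverson d ≡ 0ℚ
iverson-no (yes a) ¬a = ⊥-elim (¬a a)
iverson-no (no _)  _  = refl

0*-≡ : ∀ {x} y → x ≡ 0ℚ → x * y ≡ 0ℚ
0*-≡ y refl = ℚ.*-zeroˡ y

*0-≡ : ∀ x {y} → y ≡ 0ℚ → x * y ≡ 0ℚ
*0-≡ x refl = ℚ.*-zeroʳ x

1*-≡ : ∀ {x} y → x ≡ 1ℚ → x * y ≡ y
1*-≡ y refl = ℚ.*-identityˡ y

0+-≡ : ∀ {x} {y z} → x ≡ 0ℚ → y ≡ z → x + y ≡ z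
0+-≡ {y = y} refl refl = ℚ.+-identityˡ y

+0-≡ : ∀ {x} {y z} → y ≡ 0ℚ → x ≡ z → x + y ≡ z
+0-≡ {x = x} refl refl = ℚ.+-identityʳ x

-- Finite sums over enumerated sets.

-- Opaque, so that summands are inferred by unification.
opaque
  Sum : (V : FinSet) → (Carrier V → ℚ) → ℚ
  Sum = ∑

  Sum≡∑ : ∀ V f → Sum V f ≡ ∑ V f
  Sum≡∑ V f = refl

  Sum-cong : ∀ V {f g : Carrier V → ℚ} → (∀ v → f v ≡ g v) → Sum V f ≡ Sum V g
  Sum-cong V {f} {g} f≡g =
    sum-cong-≗ {x = λ i → f (Inverse.to (enum V) i)} {y = λ i → g (Inverse.to (enum V) i)} (λ i → f≡g (Inverse.to (enum V) i))

  Sum-0 : ∀ V → Sum V (λ _ → 0ℚ) ≡ 0ℚ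
  Sum-0 V = sum-replicate-zero (size V)

  Sum-+ : ∀ V (f g : Carrier V → ℚ) → Sum V (λ v → f v + g v) ≡ Sum V f + Sum V g
  Sum-+ V f g = ∑-distrib-+ (λ i → f (Inverse.to (enum V) i)) (λ i → g (Inverse.to (enum V) i))

  Sum-*ˡ : ∀ V c (f : Carrier V → ℚ) → Sum V (λ v → c * f v) ≡ c * Sum V f
  Sum-*ˡ V c f = sym (*-distribˡ-sum c (λ i → f (Inverse.to (enum V) i)))

  Sum-swap : ∀ V W (f : Carrier V → Carrier W → ℚ) →
             Sum V (λ v → Sum W (f v)) ≡ Sum W (λ w → Sum V (λ v → f v w))
  Sum-swap V W f = ∑-comm (λ i j → f (Inverse.to (enum V) i) (Inverse.to (enum W) j))

  Sum-Fin-suc : ∀ n (f : Fin (suc n) → ℚ) → Sum ⟦Fin suc n ⟧ f ≡ f zero + Sum ⟦Fin n ⟧ (f ∘ suc)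
  Sum-Fin-suc n f = refl

  Sum-enum : ∀ V (f : Carrier V → ℚ) → Sum V f ≡ Sum ⟦Fin size V ⟧ (f ∘ Inverse.to (enum V))
  Sum-enum V f = refl

Sum-zero : ∀ V {f : Carrier V → ℚ} → (∀ v → f v ≡ 0ℚ) → Sum V f ≡ 0ℚ
Sum-zero V f≡0 = trans (Sum-cong V f≡0) (Sum-0 V)

Sum-*ʳ : ∀ V c (f : Carrier V → ℚ) → Sum V (λ v → f v * c) ≡ Sum V f * c
Sum-*ʳ V c f = trans (Sum-cong V λ v → ℚ.*-comm (f v) c)
                     (trans (Sum-*ˡ V c f) (ℚ.*-comm c (Sum V f)))

Sum-neg : ∀ V (f : Carrier V → ℚ) → Sum V (λ v → - f v) ≡ - Sum V f
Sum-neg V f = trans (Sum-cong V λ v → sym (-1* (f v)))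
  (trans (Sum-*ˡ V (- 1ℚ) f) (-1* (Sum V f)))

Sum-Fin-single : ∀ n {f : Fin n → ℚ} i → (∀ j → j ≢ i → f j ≡ 0ℚ) → Sum ⟦Fin n ⟧ f ≡ f i
Sum-Fin-single (suc n) {f} zero    f≡0 = trans (Sum-Fin-suc n f)
  (+0-≡ (Sum-zero ⟦Fin n ⟧ (λ j → f≡0 (suc j) λ ())) refl)
Sum-Fin-single (suc n) {f} (suc i) f≡0 = trans (Sum-Fin-suc n f)
  (0+-≡ (f≡0 zero λ ()) (Sum-Fin-single n i λ j j≢i → f≡0 (suc j) (j≢i ∘ Fin.suc-injective)))

Sum-single : ∀ V {f : Carrier V → ℚ} u → (∀ v → v ≢ u → f v ≡ 0ℚ) → Sum V f ≡ f u
Sum-single V {f} u f≡0 = trans (Sum-enum V f) (trans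
  (Sum-Fin-single (size V) (from u) λ j j≢ → f≡0 (to j) λ to≡u →
    j≢ (trans (sym (strictlyInverseʳ j)) (cong from to≡u)))
  (cong f (strictlyInverseˡ u)))
  where open Inverse (enum V)

module _ (V : FinSet) where
  open FinSet V using (_≟ᶜ_)

  𝟙-refl : ∀ u → 𝟙 V u u ≡ 1ℚ
  𝟙-refl u = iverson-yes (u ≟ᶜ u) refl

  𝟙-≢ : ∀ {u v} → u ≢ v → 𝟙 V u v ≡ 0ℚ
  𝟙-≢ {u} {v} = iverson-no (u ≟ᶜ v)

  𝟙-sym : ∀ u v → 𝟙 V u v ≡ 𝟙 V v u
  𝟙-sym u v = go (u ≟ᶜ v)
    where
    go : Dec (u ≡ v) → 𝟙 V u v ≡ 𝟙 V v u
    go (yes refl) = refl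
    go (no u≢v)   = trans (𝟙-≢ u≢v) (sym (𝟙-≢ (u≢v ∘ sym)))

  Sum-𝟙ˡ : ∀ (f : Carrier V → ℚ) u → Sum V (λ v → 𝟙 V u v * f v) ≡ f u
  Sum-𝟙ˡ f u = trans (Sum-single V u λ v v≢u → 0*-≡ (f v) (𝟙-≢ (v≢u ∘ sym))) (1*-≡ (f u) (𝟙-refl u))

  Sum-𝟙ʳ : ∀ (f : Carrier V → ℚ) u → Sum V (λ v → 𝟙 V v u * f v) ≡ f u
  Sum-𝟙ʳ f u = trans (Sum-cong V λ v → cong (_* f v) (𝟙-sym v u)) (Sum-𝟙ˡ f u)

-- Each term is spread out as a sum against `𝟙` and the two sums are exchanged, so the order in
-- which the subset is enumerated never has to be unfolded. `Sum-⊗` and `Sum-⊕` rest on the same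
-- device.
Sum-subset : ∀ V {P : Pred (Carrier V) 0ℓ} (P? : Decidable P) (f : Carrier V → ℚ) →
             (∀ v → ¬ P v → f v ≡ 0ℚ) → Sum (subset V P?) (f ∘ value) ≡ Sum V f
Sum-subset V {P} P? f f≡0 = begin
  Sum S (f ∘ value)                                 ≡⟨ Sum-cong S (λ s → Sum-𝟙ˡ V f (value s)) ⟨
  Sum S (λ s → Sum V (λ v → 𝟙 V (value s) v * f v)) ≡⟨ Sum-swap S V (λ s v → 𝟙 V (value s) v * f v) ⟩
  Sum V (λ v → Sum S (λ s → 𝟙 V (value s) v * f v)) ≡⟨ Sum-cong V fibre ⟩
  Sum V f                                           ∎
  where
  open ≡-Reasoning
  S = subset V P?
  fibre : ∀ v → Sum S (λ s → 𝟙 V (value s) v * f v) ≡ f v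
  fibre v with P? v
  ... | yes p = trans (Sum-single S (v , [ p ]) λ s s≢ → 0*-≡ (f v) (𝟙-≢ V λ { refl → s≢ refl }))
                      (1*-≡ (f v) (𝟙-refl V v))
  ... | no ¬p = trans (Sum-zero S λ s → *0-≡ (𝟙 V (value s) v) (f≡0 v ¬p)) (sym (f≡0 v ¬p))

Sum-⊗ : ∀ V W (f : Carrier (V ⊗ W) → ℚ) →
        Sum (V ⊗ W) f ≡ Sum V (λ v → Sum W (λ w → f (v , w)))
Sum-⊗ V W f = begin
  Sum VW f
    ≡⟨ Sum-cong VW spread ⟨
  Sum VW (λ p → Sum V λ v → Sum W λ w → 𝟙 VW p (v , w) * f (v , w))
    ≡⟨ Sum-swap VW V (λ p v → Sum W λ w → 𝟙 VW p (v , w) * f (v , w)) ⟩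
  Sum V (λ v → Sum VW λ p → Sum W λ w → 𝟙 VW p (v , w) * f (v , w))
    ≡⟨ Sum-cong V (λ v → trans (Sum-swap VW W (λ p w → 𝟙 VW p (v , w) * f (v , w)))
                               (Sum-cong W λ w → Sum-𝟙ʳ VW (λ _ → f (v , w)) (v , w))) ⟩
  Sum V (λ v → Sum W (λ w → f (v , w)))  ∎
  where
  open ≡-Reasoning
  VW = V ⊗ W
  spread : ∀ p → Sum V (λ v → Sum W λ w → 𝟙 VW p (v , w) * f (v , w)) ≡ f p
  spread p@(a , b) = trans
    (Sum-single V a λ v v≢a → Sum-zero W λ w →
      0*-≡ (f (v , w)) (𝟙-≢ VW {p} {v , w} (v≢a ∘ sym ∘ cong proj₁)))
    (trans (Sum-single W b λ w w≢b → 0*-≡ (f (a , w)) (𝟙-≢ VW {p} {a , w} (w≢b ∘ sym ∘ cong proj₂)))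
           (1*-≡ (f p) (𝟙-refl VW p)))

Sum-⊕ : ∀ V W (f : Carrier (V ⊕ W) → ℚ) →
        Sum (V ⊕ W) f ≡ Sum V (f ∘ inj₁) + Sum W (f ∘ inj₂)
Sum-⊕ V W f = begin
  Sum VW f
    ≡⟨ Sum-cong VW spread ⟨
  Sum VW (λ p → Sum V (λ v → 𝟙 VW p (inj₁ v) * f (inj₁ v)) + Sum W (λ w → 𝟙 VW p (inj₂ w) * f (inj₂ w)))
    ≡⟨ Sum-+ VW (λ p → Sum V (λ v → 𝟙 VW p (inj₁ v) * f (inj₁ v)))
                (λ p → Sum W (λ w → 𝟙 VW p (inj₂ w) * f (inj₂ w))) ⟩
  Sum VW (λ p → Sum V (λ v → 𝟙 VW p (inj₁ v) * f (inj₁ v))) +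
  Sum VW (λ p → Sum W (λ w → 𝟙 VW p (inj₂ w) * f (inj₂ w)))
    ≡⟨ cong₂ _+_
         (trans (Sum-swap VW V λ p v → 𝟙 VW p (inj₁ v) * f (inj₁ v))
                (Sum-cong V λ v → Sum-𝟙ʳ VW (λ _ → f (inj₁ v)) (inj₁ v)))
         (trans (Sum-swap VW W λ p w → 𝟙 VW p (inj₂ w) * f (inj₂ w))
                (Sum-cong W λ w → Sum-𝟙ʳ VW (λ _ → f (inj₂ w)) (inj₂ w))) ⟩
  Sum V (f ∘ inj₁) + Sum W (f ∘ inj₂)  ∎
  where
  open ≡-Reasoning
  VW = V ⊕ W
  spread : ∀ p → Sum V (λ v → 𝟙 VW p (inj₁ v) * f (inj₁ v)) +
                 Sum W (λ w → 𝟙 VW p (inj₂ w) * f (inj₂ w)) ≡ f p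
  spread p@(inj₁ u) = +0-≡
    (Sum-zero W λ w → 0*-≡ (f (inj₂ w)) (𝟙-≢ VW {p} {inj₂ w} λ ()))
    (trans (Sum-single V u λ v v≢u → 0*-≡ (f (inj₁ v)) (𝟙-≢ VW {p} {inj₁ v} (v≢u ∘ sym ∘ inj₁-injective)))
           (1*-≡ (f p) (𝟙-refl VW p)))
  spread p@(inj₂ u) = 0+-≡
    (Sum-zero V λ v → 0*-≡ (f (inj₁ v)) (𝟙-≢ VW {p} {inj₁ v} λ ()))
    (trans (Sum-single W u λ w w≢u → 0*-≡ (f (inj₂ w)) (𝟙-≢ VW {p} {inj₂ w} (w≢u ∘ sym ∘ inj₂-injective)))
           (1*-≡ (f p) (𝟙-refl VW p)))

-- Linear algebra over ℚ: injectivity, left inverses and similarity.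

Injective : ∀ V W → Matrix V W → Set
Injective V W A = ∀ (x : Carrier W → ℚ) → (∀ v → Sum W (λ w → A v w * x w) ≡ 0ℚ) → ∀ w → x w ≡ 0ℚ

-- `product` with the opaque sum.
mul : ∀ U V W → Matrix U V → Matrix V W → Matrix U W
mul U V W A B u w = Sum V λ v → A u v * B v w

mul-assoc : ∀ U V W X (A : Matrix U V) (B : Matrix V W) (C : Matrix W X) →
  mul U W X (mul U V W A B) C ≐ mul U V X A (mul V W X B C)
mul-assoc U V W X A B C u x = begin
  Sum W (λ w → Sum V (λ v → A u v * B v w) * C w x)     ≡⟨ Sum-cong W (λ w → Sum-*ʳ V (C w x) (λ v → A u v * B v w)) ⟨
  Sum W (λ w → Sum V (λ v → A u v * B v w * C w x))     ≡⟨ Sum-swap W V (λ w v → A u v * B v w * C w x) ⟩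
  Sum V (λ v → Sum W (λ w → A u v * B v w * C w x))     ≡⟨ Sum-cong V (λ v → Sum-cong W λ w → ℚ.*-assoc (A u v) (B v w) (C w x)) ⟩
  Sum V (λ v → Sum W (λ w → A u v * (B v w * C w x)))   ≡⟨ Sum-cong V (λ v → Sum-*ˡ W (A u v) (λ w → B v w * C w x)) ⟩
  Sum V (λ v → A u v * Sum W (λ w → B v w * C w x))     ∎
  where open ≡-Reasoning

mul-congˡ : ∀ U V W (A : Matrix U V) {B B′ : Matrix V W} → B ≐ B′ → mul U V W A B ≐ mul U V W A B′
mul-congˡ U V W A B≐B′ u w = Sum-cong V λ v → cong (A u v *_) (B≐B′ v w)

mul-congʳ : ∀ U V W {A A′ : Matrix U V} (B : Matrix V W) → A ≐ A′ → mul U V W A B ≐ mul U V W A′ B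
mul-congʳ U V W B A≐A′ u w = Sum-cong V λ v → cong (_* B v w) (A≐A′ u v)

mul-𝟙ˡ : ∀ V W (A : Matrix V W) → mul V V W (𝟙 V) A ≐ A
mul-𝟙ˡ V W A v w = Sum-𝟙ˡ V (λ v → A v w) v

mul-𝟙ʳ : ∀ V W (A : Matrix V W) → mul V W W A (𝟙 W) ≐ A
mul-𝟙ʳ V W A v w = trans (Sum-cong W λ w′ → ℚ.*-comm (A v w′) (𝟙 W w′ w)) (Sum-𝟙ʳ W (A v) w)

1ℚ≢0ℚ : 1ℚ ≢ 0ℚ
1ℚ≢0ℚ ()

-- Induction on the number of columns: the residue r of the first column modulo
-- the others is nonzero in some row v₀, and ℓ reads off that entry.
leftInverse-Fin : ∀ V n (A : Matrix V ⟦Fin n ⟧) → Injective V ⟦Fin n ⟧ A →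
  Σ[ B ∈ Matrix ⟦Fin n ⟧ V ] mul ⟦Fin n ⟧ V ⟦Fin n ⟧ B A ≐ 𝟙 ⟦Fin n ⟧
leftInverse-Fin V zero    A inj = (λ ()) , λ ()
leftInverse-Fin V (suc n) A inj = B , BA≐1
  where
  open ≡-Reasoning
  A′ : Matrix V ⟦Fin n ⟧
  A′ v j = A v (suc j)

  extend : ℚ → (Fin n → ℚ) → Fin (suc n) → ℚ
  extend a x zero    = a
  extend a x (suc j) = x j

  inj′ : Injective V ⟦Fin n ⟧ A′
  inj′ x A′x≡0 j = inj (extend 0ℚ x)
    (λ v → trans (Sum-Fin-suc n (λ j → A v j * extend 0ℚ x j)) (0+-≡ (ℚ.*-zeroʳ (A v zero)) (A′x≡0 v)))
    (suc j)

  IH = leftInverse-Fin V n A′ inj′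
  B′ = proj₁ IH

  d : Fin n → ℚ
  d j = Sum V λ v → B′ j v * A v zero

  r : Carrier V → ℚ
  r v = A v zero - Sum ⟦Fin n ⟧ (λ j → A′ v j * d j)

  r≢0 : ∃ λ i → r (Inverse.to (enum V) i) ≢ 0ℚ
  r≢0 with Fin.any? (λ i → ¬? (r (Inverse.to (enum V) i) ℚ.≟ 0ℚ))
  ... | yes e = e
  -- If `r` vanished everywhere, the first column would be `A′` applied to `d`, and (1, -`d`) would
  -- be a nonzero kernel vector of `A`.
  ... | no ¬e = ⊥-elim (1ℚ≢0ℚ (inj (extend 1ℚ (-_ ∘ d)) kernel zero))
    where
    r≡0 : ∀ v → r v ≡ 0ℚ
    r≡0 v with r v ℚ.≟ 0ℚ
    ... | yes e = e
    ... | no ¬r = ⊥-elim (¬e (from v , λ e → ¬r (trans (cong r (sym (strictlyInverseˡ v))) e)))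
      where open Inverse (enum V)
    kernel : ∀ v → Sum ⟦Fin suc n ⟧ (λ j → A v j * extend 1ℚ (-_ ∘ d) j) ≡ 0ℚ
    kernel v = trans (Sum-Fin-suc n (λ j → A v j * extend 1ℚ (-_ ∘ d) j))
      (trans (cong₂ _+_ (ℚ.*-identityʳ (A v zero))
        (trans (Sum-cong ⟦Fin n ⟧ λ j → sym (ℚ.neg-distribʳ-* (A′ v j) (d j)))
               (Sum-neg ⟦Fin n ⟧ (λ j → A′ v j * d j))))
      (r≡0 v))

  v₀ = Inverse.to (enum V) (proj₁ r≢0)

  instance
    r-nonZero : ℚ.NonZero (r v₀)
    r-nonZero = ℚ.≢-nonZero (proj₂ r≢0)

  c = ℚ.1/ (r v₀)

  -- The functional x ↦ (x - `A′` `B′` x) at `v₀` kills the columns of `A′`, since `B′` `A′` = 1,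
  -- and sends the first column to `r v₀`; `c` normalises that value. Subtracting `d j` times `ℓ` in
  -- `B` then clears the first column from the remaining rows.
  ℓ : Carrier V → ℚ
  ℓ v = c * (𝟙 V v₀ v - Sum ⟦Fin n ⟧ (λ j → A′ v₀ j * B′ j v))

  B : Matrix ⟦Fin suc n ⟧ V
  B zero    v = ℓ v
  B (suc j) v = B′ j v + (- d j) * ℓ v

  B′A : Fin n → Fin (suc n) → ℚ
  B′A j k = Sum V λ v → B′ j v * A v k

  ℓA : ∀ k → Sum V (λ v → ℓ v * A v k) ≡
             c * (A v₀ k - Sum ⟦Fin n ⟧ (λ j → A′ v₀ j * B′A j k))
  ℓA k = begin
    Sum V (λ v → c * (𝟙 V v₀ v - σ v) * A v k)
      ≡⟨ Sum-cong V (λ v → expand c (𝟙 V v₀ v) (σ v) (A v k)) ⟩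
    Sum V (λ v → c * (𝟙 V v₀ v * A v k + - (σ v * A v k)))
      ≡⟨ Sum-*ˡ V c (λ v → 𝟙 V v₀ v * A v k + - (σ v * A v k)) ⟩
    c * Sum V (λ v → 𝟙 V v₀ v * A v k + - (σ v * A v k))
      ≡⟨ cong (c *_) (Sum-+ V (λ v → 𝟙 V v₀ v * A v k) (λ v → - (σ v * A v k))) ⟩
    c * (Sum V (λ v → 𝟙 V v₀ v * A v k) + Sum V (λ v → - (σ v * A v k)))
      ≡⟨ cong (c *_) (cong₂ _+_ (Sum-𝟙ˡ V (λ v → A v k) v₀)
           (trans (Sum-neg V (λ v → σ v * A v k))
                  (cong -_ (mul-assoc ⟦Fin 1 ⟧ ⟦Fin n ⟧ V ⟦Fin 1 ⟧ (λ _ → A′ v₀) B′ (λ v _ → A v k) zero zero)))) ⟩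
    c * (A v₀ k - Sum ⟦Fin n ⟧ (λ j → A′ v₀ j * B′A j k)) ∎
    where
    σ : Carrier V → ℚ
    σ v = Sum ⟦Fin n ⟧ (λ j → A′ v₀ j * B′ j v)
    expand : ∀ c a s b → c * (a - s) * b ≡ c * (a * b + - (s * b))
    expand = solve-∀ ℚ-ring

  ℓA-suc : ∀ k → Sum V (λ v → ℓ v * A v (suc k)) ≡ 0ℚ
  ℓA-suc k = trans (ℓA (suc k)) (*0-≡ c (trans
    (cong (λ t → A v₀ (suc k) - t) (trans (mul-congˡ ⟦Fin 1 ⟧ ⟦Fin n ⟧ ⟦Fin n ⟧ (λ _ → A′ v₀) (proj₂ IH) zero k)
                                          (mul-𝟙ʳ ⟦Fin 1 ⟧ ⟦Fin n ⟧ (λ _ → A′ v₀) zero k)))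
    (ℚ.+-inverseʳ (A v₀ (suc k)))))

  ℓA-zero : Sum V (λ v → ℓ v * A v zero) ≡ 1ℚ
  ℓA-zero = trans (ℓA zero) (ℚ.*-inverseˡ (r v₀))

  BA-suc : ∀ j k → Sum V (λ v → B (suc j) v * A v k) ≡
           B′A j k + (- d j) * Sum V (λ v → ℓ v * A v k)
  BA-suc j k = begin
    Sum V (λ v → (B′ j v + (- d j) * ℓ v) * A v k)
      ≡⟨ Sum-cong V (λ v → expand (B′ j v) (- d j) (ℓ v) (A v k)) ⟩
    Sum V (λ v → B′ j v * A v k + (- d j) * (ℓ v * A v k))
      ≡⟨ Sum-+ V (λ v → B′ j v * A v k) (λ v → (- d j) * (ℓ v * A v k)) ⟩
    B′A j k + Sum V (λ v → (- d j) * (ℓ v * A v k))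
      ≡⟨ cong (B′A j k +_) (Sum-*ˡ V (- d j) (λ v → ℓ v * A v k)) ⟩
    B′A j k + (- d j) * Sum V (λ v → ℓ v * A v k) ∎
    where
    expand : ∀ b d l a → (b + d * l) * a ≡ b * a + d * (l * a)
    expand = solve-∀ ℚ-ring

  BA≐1 : mul ⟦Fin suc n ⟧ V ⟦Fin suc n ⟧ B A ≐ 𝟙 ⟦Fin suc n ⟧
  BA≐1 zero    zero    = ℓA-zero
  BA≐1 zero    (suc k) = ℓA-suc k
  BA≐1 (suc j) zero    = trans (BA-suc j zero) (trans
    (cong (λ t → d j + (- d j) * t) ℓA-zero)
    (trans (cong (d j +_) (ℚ.*-identityʳ (- d j))) (ℚ.+-inverseʳ (d j))))
  BA≐1 (suc j) (suc k) = trans (BA-suc j (suc k))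
    (+0-≡ (*0-≡ (- d j) (ℓA-suc k)) (proj₂ IH j k))

leftInverse : ∀ V W (A : Matrix V W) → Injective V W A →
              Σ[ B ∈ Matrix W V ] mul W V W B A ≐ 𝟙 W
leftInverse V W A inj = (λ w v → B (from w) v) ,
  λ w w′ → trans (Sum-cong V λ v → cong (λ u → B (from w) v * A v u) (sym (strictlyInverseˡ w′)))
                 (proj₂ BA≐1 (from w) (from w′))
  where
  open Inverse (enum W)
  A′ : Matrix V ⟦Fin size W ⟧
  A′ v j = A v (to j)
  inj′ : Injective V ⟦Fin size W ⟧ A′
  inj′ x A′x≡0 j = trans (cong x (sym (strictlyInverseʳ j))) (inj (x ∘ from)
    (λ v → trans (Sum-enum W (λ w → A v w * x (from w)))
      (trans (Sum-cong ⟦Fin size W ⟧ λ i → cong (λ k → A v (to i) * x k) (strictlyInverseʳ i)) (A′x≡0 v))) (to j))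
  BA≐1 = leftInverse-Fin V (size W) A′ inj′
  B = proj₁ BA≐1

-- Injectivity of `T` gives a left inverse S, injectivity of its transpose a right inverse S′, and S
-- = S T S′ = S′. Thus `T` is invertible without comparing the sizes of `V` and `W`, and S A T = S T
-- B = B.
similar-intertwined : ∀ V W (A : Matrix V V) (B : Matrix W W) (T : Matrix V W) →
  mul V V W A T ≐ mul V W W T B →
  Injective V W T → Injective W V (λ w v → T v w) → Similar V W A B
similar-intertwined V W A B T AT≐TB inj injᵗ =
  T , S , transparent V W V T S TS≐1 , transparent W V W S T (proj₂ ST≐1) , SAT≐B
  where
  open ≡-Reasoning
  transparent : ∀ U V W (A : Matrix U V) (B : Matrix V W) {C : Matrix U W} →
                mul U V W A B ≐ C → product U V W A B ≐ C
  transparent U V W A B eq u w = trans (sym (Sum≡∑ V λ v → A u v * B v w)) (eq u w)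
  ST≐1 = leftInverse V W T inj
  S = proj₁ ST≐1
  STᵗ≐1 = leftInverse W V (λ w v → T v w) injᵗ
  S′ : Matrix W V
  S′ w v = proj₁ STᵗ≐1 v w
  TS′≐1 : mul V W V T S′ ≐ 𝟙 V
  TS′≐1 u v = trans (Sum-cong W λ w → ℚ.*-comm (T u w) (S′ w v))
    (trans (proj₂ STᵗ≐1 v u) (𝟙-sym V v u))
  S≐S′ : S ≐ S′
  S≐S′ w v = begin
    S w v                              ≡⟨ mul-𝟙ʳ W V S w v ⟨
    mul W V V S (𝟙 V) w v              ≡⟨ mul-congˡ W V V S TS′≐1 w v ⟨
    mul W V V S (mul V W V T S′) w v   ≡⟨ mul-assoc W V W V S T S′ w v ⟨
    mul W W V (mul W V W S T) S′ w v   ≡⟨ mul-congʳ W W V S′ (proj₂ ST≐1) w v ⟩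
    mul W W V (𝟙 W) S′ w v             ≡⟨ mul-𝟙ˡ W V S′ w v ⟩
    S′ w v                             ∎
  TS≐1 : mul V W V T S ≐ 𝟙 V
  TS≐1 u v = trans (mul-congˡ V W V T S≐S′ u v) (TS′≐1 u v)
  SAT≐B : product W V W (product W V V S A) T ≐ B
  SAT≐B w w′ = begin
    product W V W (product W V V S A) T w w′   ≡⟨ Sum≡∑ V (λ v → product W V V S A w v * T v w′) ⟨
    mul W V W (product W V V S A) T w w′       ≡⟨ mul-congʳ W V W T (λ w v → sym (Sum≡∑ V λ u → S w u * A u v)) w w′ ⟩
    mul W V W (mul W V V S A) T w w′           ≡⟨ mul-assoc W V V W S A T w w′ ⟩
    mul W V W S (mul V V W A T) w w′           ≡⟨ mul-congˡ W V W S AT≐TB w w′ ⟩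
    mul W V W S (mul V W W T B) w w′           ≡⟨ mul-assoc W V W W S T B w w′ ⟨
    mul W W W (mul W V W S T) B w w′           ≡⟨ mul-congʳ W W W B (proj₂ ST≐1) w w′ ⟩
    mul W W W (𝟙 W) B w w′                     ≡⟨ mul-𝟙ˡ W W B w w′ ⟩
    B w w′                                     ∎

-- Signs and positivity in ℚ.

2x≡0⇒x≡0 : ∀ {x} → x + x ≡ 0ℚ → x ≡ 0ℚ
2x≡0⇒x≡0 {x} eq = begin
  x                        ≡⟨ ℚ.*-identityˡ x ⟨
  (ℚ.½ + ℚ.½) * x          ≡⟨ distribute ℚ.½ x ⟩
  ℚ.½ * (x + x)            ≡⟨ *0-≡ ℚ.½ eq ⟩
  0ℚ                       ∎
  where
  open ≡-Reasoning
  distribute : ∀ h x → (h + h) * x ≡ h * (x + x)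
  distribute = solve-∀ ℚ-ring

x≡-x⇒x≡0 : ∀ {x} → x ≡ - x → x ≡ 0ℚ
x≡-x⇒x≡0 {x} eq = 2x≡0⇒x≡0 (trans (cong (x +_) eq) (ℚ.+-inverseʳ x))

x*x≥0 : ∀ x → 0ℚ ℚ.≤ x * x
x*x≥0 x with ℚ.≤-total 0ℚ x
... | inj₁ 0≤x = ℚ.nonNegative⁻¹ (x * x) {{ℚ.nonNeg*nonNeg⇒nonNeg x {{ℚ.nonNegative 0≤x}} x {{ℚ.nonNegative 0≤x}}}}
... | inj₂ x≤0 = ℚ.nonNegative⁻¹ (x * x) {{ℚ.nonPos*nonPos⇒nonPos x {{ℚ.nonPositive x≤0}} x {{ℚ.nonPositive x≤0}}}}

x*x≡0⇒x≡0 : ∀ x → x * x ≡ 0ℚ → x ≡ 0ℚ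
x*x≡0⇒x≡0 x eq with x ℚ.≟ 0ℚ
... | yes x≡0 = x≡0
... | no x≢0 = begin
  x                    ≡⟨ 1*-≡ x (ℚ.*-inverseˡ x) ⟨
  (ℚ.1/ x * x) * x     ≡⟨ ℚ.*-assoc (ℚ.1/ x) x x ⟩
  ℚ.1/ x * (x * x)     ≡⟨ *0-≡ (ℚ.1/ x) eq ⟩
  0ℚ                   ∎
  where
  open ≡-Reasoning
  instance
    x-nonZero : ℚ.NonZero x
    x-nonZero = ℚ.≢-nonZero x≢0

Sum-nonNeg : ∀ n {f : Fin n → ℚ} → (∀ i → 0ℚ ℚ.≤ f i) → 0ℚ ℚ.≤ Sum ⟦Fin n ⟧ f
Sum-nonNeg zero    {f} f≥0 = ℚ.≤-reflexive (sym (Sum-zero ⟦Fin 0 ⟧ λ ()))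
Sum-nonNeg (suc n) {f} f≥0 = subst (0ℚ ℚ.≤_) (sym (Sum-Fin-suc n f))
  (ℚ.+-mono-≤ (f≥0 zero) (Sum-nonNeg n (f≥0 ∘ suc)))

nonNeg-+≡0 : ∀ {x y} → 0ℚ ℚ.≤ x → 0ℚ ℚ.≤ y → x + y ≡ 0ℚ → x ≡ 0ℚ × y ≡ 0ℚ
nonNeg-+≡0 {x} {y} x≥0 y≥0 eq = x≡0 , trans (sym (0+-≡ x≡0 refl)) eq
  where
  x≡0 = ℚ.≤-antisym (subst₂ ℚ._≤_ (ℚ.+-identityʳ x) eq (ℚ.+-monoʳ-≤ x y≥0)) x≥0

Sum-nonNeg-≡0 : ∀ n {f : Fin n → ℚ} → (∀ i → 0ℚ ℚ.≤ f i) → Sum ⟦Fin n ⟧ f ≡ 0ℚ → ∀ i → f i ≡ 0ℚ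
Sum-nonNeg-≡0 (suc n) {f} f≥0 eq i with nonNeg-+≡0 (f≥0 zero) (Sum-nonNeg n (f≥0 ∘ suc)) (trans (sym (Sum-Fin-suc n f)) eq)
Sum-nonNeg-≡0 (suc n) {f} f≥0 eq zero    | f0≡0 , _    = f0≡0
Sum-nonNeg-≡0 (suc n) {f} f≥0 eq (suc i) | _    , rest = Sum-nonNeg-≡0 n (f≥0 ∘ suc) rest i

-- Entries of the path matrix and alternating signs.

step : ℕ → ℕ → ℚ
step i j = iverson (∣ i - j ∣ ℕ.≟ 1)

step-sym : ∀ i j → step i j ≡ step j i
step-sym i j = cong (λ d → iverson (d ℕ.≟ 1)) (ℕ.∣-∣-comm i j)

δ : ℕ → ℕ → ℚ
δ i j = iverson (i ℕ.≟ j)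

step-suc : ∀ i k → step i (suc k) ≡ δ i k + δ i (suc (suc k))
step-suc zero          zero    = refl
step-suc zero          (suc k) = refl
step-suc (suc zero)    zero    = refl
step-suc (suc (suc zero)) zero = refl
step-suc (suc (suc (suc i))) zero = refl
step-suc (suc i)       (suc k) = step-suc i k

step-zero : ∀ i → step i 0 ≡ δ i 1
step-zero zero    = refl
step-zero (suc i) = refl

module _ {N : ℕ} where

  -- The value at position k, and 0 if k is out of range.
  at : (Fin N → ℚ) → ℕ → ℚ
  at x k = Sum ⟦Fin N ⟧ λ l → δ (toℕ l) k * x l

  at-toℕ : ∀ x {k} l → toℕ l ≡ k → at x k ≡ x l
  at-toℕ x {k} l eq = trans
    (Sum-single ⟦Fin N ⟧ l λ l′ l′≢l → 0*-≡ (x l′)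
      (iverson-no (toℕ l′ ℕ.≟ k) λ eq′ → l′≢l (Fin.toℕ-injective (trans eq′ (sym eq)))))
    (1*-≡ (x l) (iverson-yes (toℕ l ℕ.≟ k) eq))

  at-≥ : ∀ x {k} → N ≤ k → at x k ≡ 0ℚ
  at-≥ x {k} N≤k = Sum-zero ⟦Fin N ⟧ λ l → 0*-≡ (x l)
    (iverson-no (toℕ l ℕ.≟ k) λ eq → ℕ.<⇒≢ (ℕ.<-≤-trans (Fin.toℕ<n l) N≤k) eq)

  -- The default value 0 of `at` absorbs the right end of the path; only the left end, which has no
  -- predecessor, needs a separate case in `Sum-step-zero`.
  Sum-step-suc : ∀ x k → Sum ⟦Fin N ⟧ (λ l → step (toℕ l) (suc k) * x l) ≡ at x k + at x (suc (suc k))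
  Sum-step-suc x k = trans
    (Sum-cong ⟦Fin N ⟧ λ l → trans (cong (_* x l) (step-suc (toℕ l) k))
                                   (ℚ.*-distribʳ-+ (x l) (δ (toℕ l) k) (δ (toℕ l) (suc (suc k)))))
    (Sum-+ ⟦Fin N ⟧ (λ l → δ (toℕ l) k * x l) (λ l → δ (toℕ l) (suc (suc k)) * x l))

  Sum-step-zero : ∀ x → Sum ⟦Fin N ⟧ (λ l → step (toℕ l) 0 * x l) ≡ at x 1
  Sum-step-zero x = Sum-cong ⟦Fin N ⟧ λ l → cong (_* x l) (step-zero (toℕ l))

sign : ℕ → ℚ
sign zero    = 1ℚ
sign (suc k) = - sign k

sign*sign : ∀ k → sign k * sign k ≡ 1ℚ
sign*sign zero    = refl
sign*sign (suc k) = trans (neg*neg (sign k)) (sign*sign k)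
  where
  neg*neg : ∀ a → (- a) * (- a) ≡ a * a
  neg*neg = solve-∀ ℚ-ring

sign-*-cancel : ∀ k {x y} → sign k * x ≡ sign k * y → x ≡ y
sign-*-cancel k {x} {y} eq = trans (sym (undo x)) (trans (cong (sign k *_) eq) (undo y))
  where
  undo : ∀ z → sign k * (sign k * z) ≡ z
  undo z = trans (sym (ℚ.*-assoc (sign k) (sign k) z)) (1*-≡ z (sign*sign k))

-- A step joins indices of opposite parity. This is the entrywise form of D P = - P D.
sign*step : ∀ i j → sign i * step i j ≡ - (sign j * step i j)
sign*step zero          zero          = refl
sign*step zero          (suc zero)    = refl
sign*step zero          (suc (suc j)) = trans (ℚ.*-zeroʳ 1ℚ) (sym (cong -_ (ℚ.*-zeroʳ (sign (suc (suc j))))))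
sign*step (suc zero)    zero          = refl
sign*step (suc (suc i)) zero          = trans (ℚ.*-zeroʳ (sign (suc (suc i)))) (sym (cong -_ (ℚ.*-zeroʳ 1ℚ)))
sign*step (suc i)       (suc j)       = begin
  (- sign i) * step i j     ≡⟨ ℚ.neg-distribˡ-* (sign i) (step i j) ⟨
  - (sign i * step i j)     ≡⟨ cong -_ (sign*step i j) ⟩
  - - (sign j * step i j)   ≡⟨ cong -_ (ℚ.neg-distribˡ-* (sign j) (step i j)) ⟩
  - ((- sign j) * step i j) ∎
  where open ≡-Reasoning

-- Operators on grids: P, D, `K` and the inner product.

module Grids (m : ℕ) where

  Grid : Set
  Grid = Fin m → Fin m → ℚ

  infix 10 _ᵗ
  _ᵗ : Grid → Grid
  (X ᵗ) i j = X j i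

  -- Grids are functions compared by `≐`, so respect for `≐` is carried as a field. Operators on
  -- grids are treated through their entries, each of which is such a form.
  record LinearForm (φ : Grid → ℚ) : Set where
    field
      ≐-cong : ∀ {X Y} → X ≐ Y → φ X ≡ φ Y
      +-homo : ∀ X Y → φ (λ i j → X i j + Y i j) ≡ φ X + φ Y
      *-homo : ∀ c X → φ (λ i j → c * X i j) ≡ c * φ X

    0-homo : ∀ {X} → (∀ i j → X i j ≡ 0ℚ) → φ X ≡ 0ℚ
    0-homo {X} X≡0 = trans (≐-cong λ i j → trans (X≡0 i j) (sym (ℚ.*-zeroˡ (X i j))))
      (trans (*-homo 0ℚ X) (ℚ.*-zeroˡ (φ X)))

    neg-homo : ∀ X → φ (λ i j → - X i j) ≡ - φ X
    neg-homo X = trans (≐-cong λ i j → sym (-1* (X i j))) (trans (*-homo (- 1ℚ) X) (-1* (φ X)))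

    -‿homo : ∀ X Y → φ (λ i j → X i j - Y i j) ≡ φ X - φ Y
    -‿homo X Y = trans (+-homo X (λ i j → - Y i j)) (cong (φ X +_) (neg-homo Y))

    Sum-Fin-homo : ∀ n (M : Fin n → Grid) (x : Fin n → ℚ) →
      φ (λ i j → Sum ⟦Fin n ⟧ λ s → M s i j * x s) ≡ Sum ⟦Fin n ⟧ λ s → φ (M s) * x s
    Sum-Fin-homo zero    M x = trans (0-homo λ i j → Sum-zero ⟦Fin 0 ⟧ λ ()) (sym (Sum-zero ⟦Fin 0 ⟧ λ ()))
    Sum-Fin-homo (suc n) M x = begin
      φ (λ i j → Sum ⟦Fin suc n ⟧ λ s → M s i j * x s)
        ≡⟨ ≐-cong (λ i j → trans (Sum-Fin-suc n λ s → M s i j * x s)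
             (cong (_+ Sum ⟦Fin n ⟧ (λ s → M (suc s) i j * x (suc s))) (ℚ.*-comm (M zero i j) (x zero)))) ⟩
      φ (λ i j → x zero * M zero i j + Sum ⟦Fin n ⟧ λ s → M (suc s) i j * x (suc s))
        ≡⟨ +-homo (λ i j → x zero * M zero i j) (λ i j → Sum ⟦Fin n ⟧ λ s → M (suc s) i j * x (suc s)) ⟩
      φ (λ i j → x zero * M zero i j) + φ (λ i j → Sum ⟦Fin n ⟧ λ s → M (suc s) i j * x (suc s))
        ≡⟨ cong₂ _+_ (trans (*-homo (x zero) (M zero)) (ℚ.*-comm (x zero) (φ (M zero))))
                     (Sum-Fin-homo n (M ∘ suc) (x ∘ suc)) ⟩
      φ (M zero) * x zero + Sum ⟦Fin n ⟧ (λ s → φ (M (suc s)) * x (suc s))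
        ≡⟨ Sum-Fin-suc n (λ s → φ (M s) * x s) ⟨
      Sum ⟦Fin suc n ⟧ (λ s → φ (M s) * x s) ∎
      where open ≡-Reasoning

    Sum-homo : ∀ S (M : Carrier S → Grid) (x : Carrier S → ℚ) →
      φ (λ i j → Sum S λ s → M s i j * x s) ≡ Sum S λ s → φ (M s) * x s
    Sum-homo S M x = trans (≐-cong λ i j → Sum-enum S λ s → M s i j * x s)
      (trans (Sum-Fin-homo (size S) (M ∘ to) (x ∘ to)) (sym (Sum-enum S λ s → φ (M s) * x s)))
      where open Inverse (enum S)

  open LinearForm

  Linear : (Grid → Grid) → Set
  Linear Φ = ∀ i j → LinearForm (λ X → Φ X i j)

  infixr 9 _∘ₗ_
  _∘ₗ_ : ∀ {φ Ψ} → LinearForm φ → Linear Ψ → LinearForm (φ ∘ Ψ)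
  _∘ₗ_ {φ} {Ψ} φ-lin Ψ-lin = record
    { ≐-cong = λ eq → ≐-cong φ-lin λ i j → ≐-cong (Ψ-lin i j) eq
    ; +-homo = λ X Y → trans (≐-cong φ-lin λ i j → +-homo (Ψ-lin i j) X Y) (+-homo φ-lin (Ψ X) (Ψ Y))
    ; *-homo = λ c X → trans (≐-cong φ-lin λ i j → *-homo (Ψ-lin i j) c X) (*-homo φ-lin c (Ψ X))
    }

  -ₗ : ∀ {φ ψ} → LinearForm φ → LinearForm ψ → LinearForm (λ X → φ X - ψ X)
  -ₗ {φ} {ψ} φ-lin ψ-lin = record
    { ≐-cong = λ eq → cong₂ _-_ (≐-cong φ-lin eq) (≐-cong ψ-lin eq)
    ; +-homo = λ X Y → trans (cong₂ _-_ (+-homo φ-lin X Y) (+-homo ψ-lin X Y)) (+-case (φ X) (φ Y) (ψ X) (ψ Y))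
    ; *-homo = λ c X → trans (cong₂ _-_ (*-homo φ-lin c X) (*-homo ψ-lin c X)) (*-case c (φ X) (ψ X))
    }
    where
    +-case : ∀ a b c d → a + b - (c + d) ≡ a - c + (b - d)
    +-case = solve-∀ ℚ-ring
    *-case : ∀ c a b → c * a - c * b ≡ c * (a - b)
    *-case = solve-∀ ℚ-ring

  -- Left and right multiplication by the adjacency matrix of the path.
  Pˡ Pʳ : Grid → Grid
  Pˡ X i j = Sum ⟦Fin m ⟧ λ k → step (toℕ k) (toℕ i) * X k j
  Pʳ X i j = Sum ⟦Fin m ⟧ λ k → step (toℕ k) (toℕ j) * X i k

  weighted-sum-linear : ∀ S (w : Carrier S → ℚ) (p : Carrier S → Fin m × Fin m) →
    LinearForm (λ X → Sum S λ s → w s * X (proj₁ (p s)) (proj₂ (p s)))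
  weighted-sum-linear S w p = record
    { ≐-cong = λ eq → Sum-cong S λ s → cong (w s *_) (eq (proj₁ (p s)) (proj₂ (p s)))
    ; +-homo = λ X Y → trans
        (Sum-cong S λ s → ℚ.*-distribˡ-+ (w s) (X (proj₁ (p s)) (proj₂ (p s))) (Y (proj₁ (p s)) (proj₂ (p s))))
        (Sum-+ S (λ s → w s * X (proj₁ (p s)) (proj₂ (p s))) (λ s → w s * Y (proj₁ (p s)) (proj₂ (p s))))
    ; *-homo = λ c X → trans
        (Sum-cong S λ s → *-left-comm (w s) c (X (proj₁ (p s)) (proj₂ (p s))))
        (Sum-*ˡ S c (λ s → w s * X (proj₁ (p s)) (proj₂ (p s))))
    }

  Pˡ-linear : Linear Pˡ
  Pˡ-linear i j = weighted-sum-linear ⟦Fin m ⟧ (λ k → step (toℕ k) (toℕ i)) (_, j)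

  Pʳ-linear : Linear Pʳ
  Pʳ-linear i j = weighted-sum-linear ⟦Fin m ⟧ (λ k → step (toℕ k) (toℕ j)) (i ,_)

  PˡPʳ-comm : ∀ X → Pˡ (Pʳ X) ≐ Pʳ (Pˡ X)
  PˡPʳ-comm X i j = begin
    Sum F (λ k → a k * Sum F (λ l → b l * X k l))      ≡⟨ Sum-cong F (λ k → Sum-*ˡ F (a k) (λ l → b l * X k l)) ⟨
    Sum F (λ k → Sum F (λ l → a k * (b l * X k l)))    ≡⟨ Sum-swap F F (λ k l → a k * (b l * X k l)) ⟩
    Sum F (λ l → Sum F (λ k → a k * (b l * X k l)))    ≡⟨ Sum-cong F (λ l → Sum-cong F λ k → *-left-comm (a k) (b l) (X k l)) ⟩
    Sum F (λ l → Sum F (λ k → b l * (a k * X k l)))    ≡⟨ Sum-cong F (λ l → Sum-*ˡ F (b l) (λ k → a k * X k l)) ⟩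
    Sum F (λ l → b l * Sum F (λ k → a k * X k l))      ∎
    where
    open ≡-Reasoning
    F = ⟦Fin m ⟧
    a b : Fin m → ℚ
    a k = step (toℕ k) (toℕ i)
    b l = step (toℕ l) (toℕ j)

  D Dʳ : Grid → Grid
  D  X i j = sign (toℕ i) * X i j
  Dʳ X i j = sign (toℕ j) * X i j

  scale-linear : (w : Fin m → Fin m → ℚ) → Linear (λ X i j → w i j * X i j)
  scale-linear w i j = record
    { ≐-cong = λ eq → cong (w i j *_) (eq i j)
    ; +-homo = λ X Y → ℚ.*-distribˡ-+ (w i j) (X i j) (Y i j)
    ; *-homo = λ c X → *-left-comm (w i j) c (X i j)
    }

  D-linear : Linear D
  D-linear = scale-linear (λ i _ → sign (toℕ i))

  Dʳ-linear : Linear Dʳ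
  Dʳ-linear = scale-linear (λ _ j → sign (toℕ j))

  DD : ∀ X → D (D X) ≐ X
  DD X i j = trans (sym (ℚ.*-assoc (sign (toℕ i)) (sign (toℕ i)) (X i j))) (1*-≡ (X i j) (sign*sign (toℕ i)))

  PˡD : ∀ X → Pˡ (D X) ≐ λ i j → - D (Pˡ X) i j
  PˡD X i j = begin
    Sum F (λ k → step (toℕ k) (toℕ i) * (sign (toℕ k) * X k j))
      ≡⟨ Sum-cong F (λ k → trans (rotate (step (toℕ k) (toℕ i)) (sign (toℕ k)) (X k j))
           (trans (cong (_* X k j) (sign*step (toℕ k) (toℕ i)))
                  (unrotate (step (toℕ k) (toℕ i)) (sign (toℕ i)) (X k j)))) ⟩
    Sum F (λ k → - sign (toℕ i) * (step (toℕ k) (toℕ i) * X k j))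
      ≡⟨ Sum-*ˡ F (- sign (toℕ i)) (λ k → step (toℕ k) (toℕ i) * X k j) ⟩
    - sign (toℕ i) * Pˡ X i j
      ≡⟨ ℚ.neg-distribˡ-* (sign (toℕ i)) (Pˡ X i j) ⟨
    - D (Pˡ X) i j ∎
    where
    open ≡-Reasoning
    F = ⟦Fin m ⟧
    rotate : ∀ a s x → a * (s * x) ≡ s * a * x
    rotate = solve-∀ ℚ-ring
    unrotate : ∀ a s x → - (s * a) * x ≡ - s * (a * x)
    unrotate = solve-∀ ℚ-ring

  PʳDʳ : ∀ X → Pʳ (Dʳ X) ≐ λ i j → - Dʳ (Pʳ X) i j
  PʳDʳ X i j = PˡD (X ᵗ) j i

  PʳD : ∀ X → Pʳ (D X) ≐ D (Pʳ X)
  PʳD X i j = *-homo (weighted-sum-linear ⟦Fin m ⟧ (λ k → step (toℕ k) (toℕ j)) (i ,_)) (sign (toℕ i)) X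

  PˡDʳ : ∀ X → Pˡ (Dʳ X) ≐ Dʳ (Pˡ X)
  PˡDʳ X i j = PʳD (X ᵗ) j i

  PˡPˡD : ∀ X → Pˡ (Pˡ (D X)) ≐ D (Pˡ (Pˡ X))
  PˡPˡD X i j = begin
    Pˡ (Pˡ (D X)) i j              ≡⟨ ≐-cong (Pˡ-linear i j) (PˡD X) ⟩
    Pˡ (λ i j → - D (Pˡ X) i j) i j ≡⟨ neg-homo (Pˡ-linear i j) (D (Pˡ X)) ⟩
    - Pˡ (D (Pˡ X)) i j            ≡⟨ cong -_ (PˡD (Pˡ X) i j) ⟩
    - - D (Pˡ (Pˡ X)) i j          ≡⟨ neg-neg (D (Pˡ (Pˡ X)) i j) ⟩
    D (Pˡ (Pˡ X)) i j              ∎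
    where
    open ≡-Reasoning

  PʳPʳD : ∀ X → Pʳ (Pʳ (D X)) ≐ D (Pʳ (Pʳ X))
  PʳPʳD X i j = trans (≐-cong (Pʳ-linear i j) (PʳD X)) (PʳD (Pʳ X) i j)

  K : Grid → Grid
  K X i j = Pˡ (Pˡ X) i j - Pʳ (Pʳ X) i j

  K-linear : Linear K
  K-linear i j = -ₗ (Pˡ-linear i j ∘ₗ Pˡ-linear) (Pʳ-linear i j ∘ₗ Pʳ-linear)

  K-ᵗ : ∀ X i j → K (X ᵗ) i j ≡ - K X j i
  -- Transposition turns `Pˡ` into `Pʳ` by definition, so only the sign of a difference is left to
  -- check.
  K-ᵗ X i j = swap (Pˡ (Pˡ (X ᵗ)) i j) (Pʳ (Pʳ (X ᵗ)) i j)
    where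
    swap : ∀ a b → a - b ≡ - (b - a)
    swap = solve-∀ ℚ-ring

  -- Each factor P anticommutes with D, so P² commutes with it. Hence the kernel of `K` is stable
  -- under D, which is how the grids D p(P) enter it.
  KD : ∀ X → K (D X) ≐ D (K X)
  KD X i j = trans (cong₂ _-_ (PˡPˡD X i j) (PʳPʳD X i j))
    (sym (-‿homo (D-linear i j) (Pˡ (Pˡ X)) (Pʳ (Pʳ X))))

  PʳPʳDʳ : ∀ X → Pʳ (Pʳ (Dʳ X)) ≐ Dʳ (Pʳ (Pʳ X))
  PʳPʳDʳ X i j = PˡPˡD (X ᵗ) j i

  KDʳ : ∀ X → K (Dʳ X) ≐ Dʳ (K X)
  KDʳ X i j = trans (cong₂ _-_ (PʳPʳD (X ᵗ) j i) (PʳPʳDʳ X i j))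
    (sym (-‿homo (Dʳ-linear i j) (Pˡ (Pˡ X)) (Pʳ (Pʳ X))))

  K-Pʳ : ∀ X → K (Pʳ X) ≐ Pʳ (K X)
  K-Pʳ X i j = begin
    Pˡ (Pˡ (Pʳ X)) i j - Pʳ (Pʳ (Pʳ X)) i j
      ≡⟨ cong (_- Pʳ (Pʳ (Pʳ X)) i j) (trans (≐-cong (Pˡ-linear i j) (PˡPʳ-comm X)) (PˡPʳ-comm (Pˡ X) i j)) ⟩
    Pʳ (Pˡ (Pˡ X)) i j - Pʳ (Pʳ (Pʳ X)) i j
      ≡⟨ -‿homo (Pʳ-linear i j) (Pˡ (Pˡ X)) (Pʳ (Pʳ X)) ⟨
    Pʳ (K X) i j ∎
    where open ≡-Reasoning

  K-PˡPʳ : ∀ X → K (Pˡ (Pʳ X)) ≐ Pˡ (Pʳ (K X))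
  K-PˡPʳ X i j = begin
    Pˡ (Pˡ (Pˡ (Pʳ X))) i j - Pʳ (Pʳ (Pˡ (Pʳ X))) i j
      ≡⟨ cong₂ _-_ (≐-cong (Pˡ-linear i j ∘ₗ Pˡ-linear) (PˡPʳ-comm X))
                   (≐-cong (Pʳ-linear i j) (λ i j → sym (PˡPʳ-comm (Pʳ X) i j))) ⟩
    Pˡ (Pˡ (Pʳ (Pˡ X))) i j - Pʳ (Pˡ (Pʳ (Pʳ X))) i j
      ≡⟨ cong₂ _-_ (≐-cong (Pˡ-linear i j) (PˡPʳ-comm (Pˡ X))) (sym (PˡPʳ-comm (Pʳ (Pʳ X)) i j)) ⟩
    Pˡ (Pʳ (Pˡ (Pˡ X))) i j - Pˡ (Pʳ (Pʳ (Pʳ X))) i j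
      ≡⟨ -‿homo (Pˡ-linear i j ∘ₗ Pʳ-linear) (Pˡ (Pˡ X)) (Pʳ (Pʳ X)) ⟨
    Pˡ (Pʳ (K X)) i j ∎
    where open ≡-Reasoning

  ⟪_,_⟫ : Grid → Grid → ℚ
  ⟪ X , Y ⟫ = Sum ⟦Fin m ⟧ λ i → Sum ⟦Fin m ⟧ λ j → X i j * Y i j

  ⟪⟫-sym : ∀ X Y → ⟪ X , Y ⟫ ≡ ⟪ Y , X ⟫
  ⟪⟫-sym X Y = Sum-cong ⟦Fin m ⟧ λ i → Sum-cong ⟦Fin m ⟧ λ j → ℚ.*-comm (X i j) (Y i j)

  ⟪⟫-ᵗ : ∀ X Y → ⟪ X ᵗ , Y ᵗ ⟫ ≡ ⟪ X , Y ⟫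
  ⟪⟫-ᵗ X Y = Sum-swap ⟦Fin m ⟧ ⟦Fin m ⟧ λ i j → X j i * Y j i

  ⟪⟫-linear : ∀ X → LinearForm ⟪ X ,_⟫
  ⟪⟫-linear X = record
    { ≐-cong = λ eq → Sum-cong ⟦Fin m ⟧ λ i → ≐-cong (rowForm i) eq
    ; +-homo = λ Y Z → trans (Sum-cong ⟦Fin m ⟧ λ i → +-homo (rowForm i) Y Z)
        (Sum-+ ⟦Fin m ⟧ (λ i → Sum ⟦Fin m ⟧ λ j → X i j * Y i j) (λ i → Sum ⟦Fin m ⟧ λ j → X i j * Z i j))
    ; *-homo = λ c Y → trans (Sum-cong ⟦Fin m ⟧ λ i → *-homo (rowForm i) c Y)
        (Sum-*ˡ ⟦Fin m ⟧ c λ i → Sum ⟦Fin m ⟧ λ j → X i j * Y i j)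
    }
    where
    rowForm : ∀ i → LinearForm (λ Y → Sum ⟦Fin m ⟧ λ j → X i j * Y i j)
    rowForm i = weighted-sum-linear ⟦Fin m ⟧ (X i) (i ,_)

  ⟪⟫-linearˡ : ∀ Y → LinearForm ⟪_, Y ⟫
  ⟪⟫-linearˡ Y = record
    { ≐-cong = λ {X} {X′} eq → trans (⟪⟫-sym X Y) (trans (≐-cong lin eq) (⟪⟫-sym Y X′))
    ; +-homo = λ X X′ → trans (⟪⟫-sym (λ i j → X i j + X′ i j) Y)
        (trans (+-homo lin X X′) (cong₂ _+_ (⟪⟫-sym Y X) (⟪⟫-sym Y X′)))
    ; *-homo = λ c X → trans (⟪⟫-sym (λ i j → c * X i j) Y)
        (trans (*-homo lin c X) (cong (c *_) (⟪⟫-sym Y X)))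
    }
    where lin = ⟪⟫-linear Y

  ⟪⟫-definite : ∀ X → ⟪ X , X ⟫ ≡ 0ℚ → ∀ i j → X i j ≡ 0ℚ
  ⟪⟫-definite X eq i j = x*x≡0⇒x≡0 (X i j)
    (Sum-nonNeg-≡0 m (λ j → x*x≥0 (X i j))
      (Sum-nonNeg-≡0 m (λ i → Sum-nonNeg m λ j → x*x≥0 (X i j)) eq i) j)

  Pˡ-adjoint : ∀ X Y → ⟪ Pˡ X , Y ⟫ ≡ ⟪ X , Pˡ Y ⟫
  Pˡ-adjoint X Y = begin
    Sum F (λ i → Sum F λ j → Sum F (λ k → a k i * X k j) * Y i j)
      ≡⟨ Sum-cong F (λ i → Sum-cong F λ j → Sum-*ʳ F (Y i j) (λ k → a k i * X k j)) ⟨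
    Sum F (λ i → Sum F λ j → Sum F (λ k → a k i * X k j * Y i j))
      ≡⟨ Sum-cong F (λ i → Sum-swap F F (λ j k → a k i * X k j * Y i j)) ⟩
    Sum F (λ i → Sum F λ k → Sum F (λ j → a k i * X k j * Y i j))
      ≡⟨ Sum-swap F F (λ i k → Sum F (λ j → a k i * X k j * Y i j)) ⟩
    Sum F (λ k → Sum F λ i → Sum F (λ j → a k i * X k j * Y i j))
      ≡⟨ Sum-cong F (λ k → Sum-swap F F (λ i j → a k i * X k j * Y i j)) ⟩
    Sum F (λ k → Sum F λ j → Sum F (λ i → a k i * X k j * Y i j))
      ≡⟨ Sum-cong F (λ k → Sum-cong F λ j → Sum-cong F λ i →
           trans (rotate (a k i) (X k j) (Y i j)) (cong (λ t → X k j * (t * Y i j)) (step-sym (toℕ k) (toℕ i)))) ⟩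
    Sum F (λ k → Sum F λ j → Sum F (λ i → X k j * (a i k * Y i j)))
      ≡⟨ Sum-cong F (λ k → Sum-cong F λ j → Sum-*ˡ F (X k j) (λ i → a i k * Y i j)) ⟩
    Sum F (λ k → Sum F λ j → X k j * Pˡ Y k j) ∎
    where
    open ≡-Reasoning
    F = ⟦Fin m ⟧
    a : Fin m → Fin m → ℚ
    a k i = step (toℕ k) (toℕ i)
    rotate : ∀ a x y → a * x * y ≡ x * (a * y)
    rotate = solve-∀ ℚ-ring

  Pʳ-adjoint : ∀ X Y → ⟪ Pʳ X , Y ⟫ ≡ ⟪ X , Pʳ Y ⟫
  Pʳ-adjoint X Y = trans (sym (⟪⟫-ᵗ (Pʳ X) Y)) (trans (Pˡ-adjoint (X ᵗ) (Y ᵗ)) (⟪⟫-ᵗ X (Pʳ Y)))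

  -- P is symmetric. Self-adjointness moves `K` across the inner product: what is orthogonal to
  -- `K X` for all antisymmetric X has an image under `K` orthogonal to all antisymmetric X.
  K-adjoint : ∀ X Y → ⟪ K X , Y ⟫ ≡ ⟪ X , K Y ⟫
  K-adjoint X Y = begin
    ⟪ K X , Y ⟫                                 ≡⟨ -‿homo (⟪⟫-linearˡ Y) (Pˡ (Pˡ X)) (Pʳ (Pʳ X)) ⟩
    ⟪ Pˡ (Pˡ X) , Y ⟫ - ⟪ Pʳ (Pʳ X) , Y ⟫           ≡⟨ cong₂ _-_ (trans (Pˡ-adjoint (Pˡ X) Y) (Pˡ-adjoint X (Pˡ Y)))
                                                             (trans (Pʳ-adjoint (Pʳ X) Y) (Pʳ-adjoint X (Pʳ Y))) ⟩
    ⟪ X , Pˡ (Pˡ Y) ⟫ - ⟪ X , Pʳ (Pʳ Y) ⟫           ≡⟨ -‿homo (⟪⟫-linear X) (Pˡ (Pˡ Y)) (Pʳ (Pʳ Y)) ⟨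
    ⟪ X , K Y ⟫                                 ∎
    where open ≡-Reasoning

  scale-adjoint : ∀ (w : Grid) X Y → ⟪ (λ i j → w i j * X i j) , Y ⟫ ≡ ⟪ X , (λ i j → w i j * Y i j) ⟫
  scale-adjoint w X Y = Sum-cong ⟦Fin m ⟧ λ i → Sum-cong ⟦Fin m ⟧ λ j → swap (w i j) (X i j) (Y i j)
    where
    swap : ∀ w x y → w * x * y ≡ x * (w * y)
    swap = solve-∀ ℚ-ring

  D-adjoint : ∀ X Y → ⟪ D X , Y ⟫ ≡ ⟪ X , D Y ⟫
  D-adjoint = scale-adjoint λ i _ → sign (toℕ i)

  Dʳ-adjoint : ∀ X Y → ⟪ Dʳ X , Y ⟫ ≡ ⟪ X , Dʳ Y ⟫
  Dʳ-adjoint = scale-adjoint λ _ j → sign (toℕ j)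

-- Chebyshev polynomials in P and the kernel of `K`.

module Chebyshev (m : ℕ) where

  open Grids m
  open LinearForm

  Zero : Grid → Set
  Zero X = ∀ i j → X i j ≡ 0ℚ

  Pˡ-column-zero : ∀ X i j → (∀ k → X k j ≡ 0ℚ) → Pˡ X i j ≡ 0ℚ
  Pˡ-column-zero X i j X≡0 = Sum-zero ⟦Fin m ⟧ λ k → *0-≡ (step (toℕ k) (toℕ i)) (X≡0 k)

  at-zero : ∀ (x : Fin m → ℚ) {k} → (∀ j → toℕ j ≡ k → x j ≡ 0ℚ) → at x k ≡ 0ℚ
  at-zero x {k} x≡0 = Sum-zero ⟦Fin m ⟧ λ l → go l (toℕ l ℕ.≟ k)
    where
    go : ∀ l → Dec (toℕ l ≡ k) → δ (toℕ l) k * x l ≡ 0ℚ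
    go l (yes eq) = *0-≡ (δ (toℕ l) k) (x≡0 l eq)
    go l (no neq) = 0*-≡ (x l) (iverson-no (toℕ l ℕ.≟ k) neq)

  Pʳ-first : ∀ X i j → toℕ j ≡ 0 → Pʳ X i j ≡ at (X i) 1
  Pʳ-first X i j eq = trans (cong (λ t → Sum ⟦Fin m ⟧ λ k → step (toℕ k) t * X i k) eq) (Sum-step-zero (X i))

  Pʳ-suc : ∀ X i j {k} → toℕ j ≡ suc k → Pʳ X i j ≡ at (X i) k + at (X i) (suc (suc k))
  Pʳ-suc X i j {k} eq = trans (cong (λ t → Sum ⟦Fin m ⟧ λ k → step (toℕ k) t * X i k) eq) (Sum-step-suc (X i) k)

  -- The argument serves as a witness that m is positive.
  first : ∀ (j : Fin m) → ∃ λ (j₀ : Fin m) → toℕ j₀ ≡ 0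
  first zero    = zero , refl
  first (suc _) = zero , refl

  -- The columns of X and of X P are determined recursively by the first two
  -- columns of X.
  K-kernel-columns : ∀ X → Zero (K X) → (∀ i j → toℕ j ≤ 1 → X i j ≡ 0ℚ) → Zero X
  K-kernel-columns X KX≡0 X≡0 i j = trans (sym (at-toℕ (X i) j refl)) (proj₁ (proj₁ (vanish (toℕ j)) i))
    where
    Vanish : ℕ → Set
    Vanish k = ∀ i → at (X i) k ≡ 0ℚ × at (Pʳ X i) k ≡ 0ℚ

    -- Since `K X` vanishes, X P² equals P² X, whose column k involves only column k of X. This
    -- closes the recursion: `next` obtains column k + 2 of X from X P, and that of X P from X P².
    PʳPʳ-zero : ∀ {k} → Vanish k → ∀ i j → toℕ j ≡ k → Pʳ (Pʳ X) i j ≡ 0ℚ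
    PʳPʳ-zero v i j eq = trans (sym (a-b≡0⇒a≡b (Pˡ (Pˡ X) i j) (Pʳ (Pʳ X) i j) (KX≡0 i j))) (Pˡ-column-zero (Pˡ X) i j λ k →
      Pˡ-column-zero X k j λ l → trans (sym (at-toℕ (X l) j eq)) (proj₁ (v l)))

    vanish0 : Vanish 0
    vanish0 i = at-zero (X i) (λ j eq → X≡0 i j (ℕ.≤-trans (ℕ.≤-reflexive eq) z≤n)) ,
      at-zero (Pʳ X i) (λ j eq → trans (Pʳ-first X i j eq)
        (at-zero (X i) (λ j eq → X≡0 i j (ℕ.≤-reflexive eq))))

    vanish1 : Vanish 1
    vanish1 i = at-zero (X i) (λ j eq → X≡0 i j (ℕ.≤-reflexive eq)) ,
      (let (j₀ , eq₀) = first i in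
       trans (sym (Pʳ-first (Pʳ X) i j₀ eq₀)) (PʳPʳ-zero vanish0 i j₀ eq₀))

    next : ∀ k → Vanish k → Vanish (suc k) → Vanish (suc (suc k))
    next k v v′ i with suc k ℕ.<? m
    ... | no ≮m  = at-≥ (X i) (ℕ.m≤n⇒m≤1+n (ℕ.≮⇒≥ ≮m)) , at-≥ (Pʳ X i) (ℕ.m≤n⇒m≤1+n (ℕ.≮⇒≥ ≮m))
    ... | yes <m =
      trans (sym (0+-≡ (proj₁ (v i)) refl))
        (trans (sym (Pʳ-suc X i l eq)) (trans (sym (at-toℕ (Pʳ X i) l eq)) (proj₂ (v′ i)))) ,
      trans (sym (0+-≡ (proj₂ (v i)) refl))
        (trans (sym (Pʳ-suc (Pʳ X) i l eq)) (PʳPʳ-zero v′ i l eq))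
      where
      l = fromℕ< <m
      eq = Fin.toℕ-fromℕ< <m

    vanish : ∀ k → Vanish k × Vanish (suc k)
    vanish zero    = vanish0 , vanish1
    vanish (suc k) = let (v , v′) = vanish k in v′ , next k v v′

  -- The Chebyshev polynomials of the second kind in the path matrix P (as
  -- polynomials in 2cos θ, they are sin (k+1)θ / sin θ).
  U : ℕ → Grid
  U zero          i j = δ (toℕ i) (toℕ j)
  U (suc zero)        = Pˡ (U zero)
  U (suc (suc k)) i j = Pˡ (U (suc k)) i j - U k i j

  step-δ : ∀ t k → k < m → Sum ⟦Fin m ⟧ (λ l → step (toℕ l) t * δ (toℕ l) k) ≡ step k t
  step-δ t k k<m = trans (Sum-cong ⟦Fin m ⟧ λ l → ℚ.*-comm (step (toℕ l) t) (δ (toℕ l) k))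
    (trans (at-toℕ (λ l → step (toℕ l) t) (fromℕ< k<m) (Fin.toℕ-fromℕ< k<m))
           (cong (λ k → step k t) (Fin.toℕ-fromℕ< k<m)))

  δ-sym : ∀ i j → δ i j ≡ δ j i
  δ-sym zero    zero    = refl
  δ-sym zero    (suc j) = refl
  δ-sym (suc i) zero    = refl
  δ-sym (suc i) (suc j) = δ-sym i j

  U₁-step : ∀ i j → U 1 i j ≡ step (toℕ j) (toℕ i)
  U₁-step i j = step-δ (toℕ i) (toℕ j) (Fin.toℕ<n j)

  U-comm : ∀ k → Pˡ (U k) ≐ Pʳ (U k)
  U-comm zero i j = trans (U₁-step i j) (trans (step-sym (toℕ j) (toℕ i))
    (sym (trans (Sum-cong ⟦Fin m ⟧ λ l → cong (step (toℕ l) (toℕ j) *_) (δ-sym (toℕ i) (toℕ l)))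
                (step-δ (toℕ j) (toℕ i) (Fin.toℕ<n i)))))
  U-comm (suc zero) i j = trans (≐-cong (Pˡ-linear i j) (U-comm zero)) (PˡPʳ-comm (U zero) i j)
  U-comm (suc (suc k)) i j = begin
    Pˡ (U (suc (suc k))) i j                 ≡⟨ -‿homo (Pˡ-linear i j) (Pˡ (U (suc k))) (U k) ⟩
    Pˡ (Pˡ (U (suc k))) i j - Pˡ (U k) i j   ≡⟨ cong₂ _-_ (trans (≐-cong (Pˡ-linear i j) (U-comm (suc k)))
                                                               (PˡPʳ-comm (U (suc k)) i j)) (U-comm k i j) ⟩
    Pʳ (Pˡ (U (suc k))) i j - Pʳ (U k) i j   ≡⟨ -‿homo (Pʳ-linear i j) (Pˡ (U (suc k))) (U k) ⟨
    Pʳ (U (suc (suc k))) i j                 ∎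
    where open ≡-Reasoning

  comm⇒K-zero : ∀ X → Pˡ X ≐ Pʳ X → Zero (K X)
  comm⇒K-zero X comm i j = trans
    (cong (_- Pʳ (Pʳ X) i j) (trans (≐-cong (Pˡ-linear i j) comm)
      (trans (PˡPʳ-comm X i j) (≐-cong (Pʳ-linear i j) comm))))
    (ℚ.+-inverseʳ (Pʳ (Pʳ X) i j))

  U-sym : ∀ k i j → U k i j ≡ U k j i
  U-sym zero          i j = δ-sym (toℕ i) (toℕ j)
  U-sym (suc zero)    i j = trans (U-comm zero i j) (≐-cong (Pʳ-linear i j) (U-sym zero))
  U-sym (suc (suc k)) i j = cong₂ _-_
    (trans (U-comm (suc k) i j) (≐-cong (Pʳ-linear i j) (U-sym (suc k)))) (U-sym k i j)

  Pˡ-U-suc : ∀ k → Pˡ (U (suc k)) ≐ λ i j → U (suc (suc k)) i j + U k i j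
  Pˡ-U-suc k i j = insert (Pˡ (U (suc k)) i j) (U k i j)
    where
    insert : ∀ a b → a ≡ a - b + b
    insert = solve-∀ ℚ-ring

  D-Pˡ : ∀ k → (∀ i j → D (U k) i j ≡ sign k * Dʳ (U k) i j) →
         ∀ i j → D (Pˡ (U k)) i j ≡ sign (suc k) * Dʳ (Pˡ (U k)) i j
  D-Pˡ k IH i j = begin
    D (Pˡ (U k)) i j                          ≡⟨ neg-neg (D (Pˡ (U k)) i j) ⟨
    - - D (Pˡ (U k)) i j                      ≡⟨ cong -_ (PˡD (U k) i j) ⟨
    - Pˡ (D (U k)) i j                        ≡⟨ cong -_ (≐-cong (Pˡ-linear i j) IH) ⟩
    - Pˡ (λ i j → sign k * Dʳ (U k) i j) i j  ≡⟨ cong -_ (*-homo (Pˡ-linear i j) (sign k) (Dʳ (U k))) ⟩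
    - (sign k * Pˡ (Dʳ (U k)) i j)            ≡⟨ cong (λ t → - (sign k * t)) (PˡDʳ (U k) i j) ⟩
    - (sign k * Dʳ (Pˡ (U k)) i j)            ≡⟨ ℚ.neg-distribˡ-* (sign k) (Dʳ (Pˡ (U k)) i j) ⟩
    (- sign k) * Dʳ (Pˡ (U k)) i j            ∎
    where
    open ≡-Reasoning

  -- As a polynomial, `U k` has only powers of P of the parity of k, and P changes parity; so `U k`
  -- is supported where i + j ≡ k modulo 2.
  D-U : ∀ k i j → D (U k) i j ≡ sign k * Dʳ (U k) i j
  D-U zero i j = go (toℕ i ℕ.≟ toℕ j)
    where
    go : Dec (toℕ i ≡ toℕ j) → D (U 0) i j ≡ 1ℚ * Dʳ (U 0) i j
    go (yes eq) = trans (cong (λ t → sign t * U 0 i j) eq) (sym (ℚ.*-identityˡ (Dʳ (U 0) i j)))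
    go (no neq) = trans (*0-≡ (sign (toℕ i)) U≡0) (sym (*0-≡ 1ℚ (*0-≡ (sign (toℕ j)) U≡0)))
      where U≡0 = iverson-no (toℕ i ℕ.≟ toℕ j) neq
  D-U (suc zero)    i j = D-Pˡ zero (D-U zero) i j
  D-U (suc (suc k)) i j = begin
    sign (toℕ i) * (Pˡ (U (suc k)) i j - U k i j)
      ≡⟨ distrib (sign (toℕ i)) (Pˡ (U (suc k)) i j) (U k i j) ⟩
    D (Pˡ (U (suc k))) i j - D (U k) i j
      ≡⟨ cong₂ _-_ (D-Pˡ (suc k) (D-U (suc k)) i j) (D-U k i j) ⟩
    sign (suc (suc k)) * Dʳ (Pˡ (U (suc k))) i j - sign k * Dʳ (U k) i j
      ≡⟨ collect (sign k) (sign (toℕ j)) (Pˡ (U (suc k)) i j) (U k i j) ⟩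
    sign (suc (suc k)) * Dʳ (U (suc (suc k))) i j ∎
    where
    open ≡-Reasoning
    distrib : ∀ s a b → s * (a - b) ≡ s * a - s * b
    distrib = solve-∀ ℚ-ring
    collect : ∀ s t a b → (- - s) * (t * a) - s * (t * b) ≡ (- - s) * (t * (a - b))
    collect = solve-∀ ℚ-ring

  -- The recurrence of `U` copies the action of P along the path, so `U k` carries the unit vector
  -- at 0 to the one at k. For k = m that position is off the path and the column is zero, which is
  -- what starts `U-m-zero`.
  U-first-column : ∀ k → k ≤ m → ∀ i j → toℕ j ≡ 0 → U k i j ≡ δ (toℕ i) k
  U-first-column zero          k≤m i j eq = cong (δ (toℕ i)) eq
  U-first-column (suc zero)    k≤m i j eq =
    trans (U₁-step i j) (trans (cong (λ t → step t (toℕ i)) eq) (trans (step-sym 0 (toℕ i)) (step-zero (toℕ i))))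
  U-first-column (suc (suc k)) k≤m i j eq = begin
    Sum ⟦Fin m ⟧ (λ l → step (toℕ l) (toℕ i) * U (suc k) l j) - U k i j
      ≡⟨ cong₂ _-_ (Sum-cong ⟦Fin m ⟧ λ l → cong (step (toℕ l) (toℕ i) *_) (U-first-column (suc k) (ℕ.<⇒≤ k≤m) l j eq))
                   (U-first-column k (ℕ.<⇒≤ (ℕ.<⇒≤ k≤m)) i j eq) ⟩
    Sum ⟦Fin m ⟧ (λ l → step (toℕ l) (toℕ i) * δ (toℕ l) (suc k)) - δ (toℕ i) k
      ≡⟨ cong (_- δ (toℕ i) k) (trans (step-δ (toℕ i) (suc k) k≤m)
           (trans (step-sym (suc k) (toℕ i)) (step-suc (toℕ i) k))) ⟩
    δ (toℕ i) k + δ (toℕ i) (suc (suc k)) - δ (toℕ i) k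
      ≡⟨ cancel (δ (toℕ i) k) (δ (toℕ i) (suc (suc k))) ⟩
    δ (toℕ i) (suc (suc k)) ∎
    where
    open ≡-Reasoning
    cancel : ∀ a b → a + b - a ≡ b
    cancel = solve-∀ ℚ-ring

  -- The characteristic polynomial of P is U m.
  U-m-zero : Zero (U m)
  U-m-zero = K-kernel-columns (U m) (comm⇒K-zero (U m) (U-comm m)) columns
    where
    column0 : ∀ i j → toℕ j ≡ 0 → U m i j ≡ 0ℚ
    column0 i j eq = trans (U-first-column m ℕ.≤-refl i j eq)
      (iverson-no (toℕ i ℕ.≟ m) (ℕ.<⇒≢ (Fin.toℕ<n i)))
    columns : ∀ i j → toℕ j ≤ 1 → U m i j ≡ 0ℚ
    columns i j j≤1 with ℕ.m≤n⇒m<n∨m≡n j≤1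
    ... | inj₁ (s≤s j≤0) = column0 i j (ℕ.n≤0⇒n≡0 j≤0)
    -- Column 1 is the first column of `U m` P, and commutation makes this P times a zero column.
    ... | inj₂ eq = let (j₀ , eq₀) = first j in begin
      U m i j           ≡⟨ at-toℕ (U m i) j eq ⟨
      at (U m i) 1      ≡⟨ Pʳ-first (U m) i j₀ eq₀ ⟨
      Pʳ (U m) i j₀     ≡⟨ U-comm m i j₀ ⟨
      Pˡ (U m) i j₀     ≡⟨ Pˡ-column-zero (U m) i j₀ (λ k → column0 k j₀ eq₀) ⟩
      0ℚ                ∎
      where open ≡-Reasoning

  -- Such an X is half of C + C D, where C is the combination of the U k with
  -- the same first column as X.
  K-kernel-orthogonal : ∀ X → Zero (K X) → Dʳ X ≐ X →
    (∀ k → k < m → ⟪ X , U k ⟫ ≡ 0ℚ) → Zero X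
  K-kernel-orthogonal X KX≡0 DʳX≐X X⊥U = ⟪⟫-definite X (2x≡0⇒x≡0 (begin
    ⟪ X , X ⟫ + ⟪ X , X ⟫        ≡⟨ +-homo (⟪⟫-linear X) X X ⟨
    ⟪ X , (λ i j → X i j + X i j) ⟫
      ≡⟨ ≐-cong (⟪⟫-linear X) (λ i j → trans (insert (X i j + X i j) (C i j + Dʳ C i j)) (0+-≡ (Z≡0 i j) refl)) ⟩
    ⟪ X , (λ i j → C i j + Dʳ C i j) ⟫ ≡⟨ +-homo (⟪⟫-linear X) C (Dʳ C) ⟩
    ⟪ X , C ⟫ + ⟪ X , Dʳ C ⟫     ≡⟨ cong (⟪ X , C ⟫ +_) (trans (sym (Dʳ-adjoint X C)) (≐-cong (⟪⟫-linearˡ C) DʳX≐X)) ⟩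
    ⟪ X , C ⟫ + ⟪ X , C ⟫        ≡⟨ 0+-≡ X⊥C X⊥C ⟩
    0ℚ                           ∎))
    where
    open ≡-Reasoning
    insert : ∀ a b → a ≡ (a - b) + b
    insert = solve-∀ ℚ-ring

    C : Grid
    C i j = Sum ⟦Fin m ⟧ λ k → U (toℕ k) i j * at (X k) 0

    X⊥C : ⟪ X , C ⟫ ≡ 0ℚ
    X⊥C = trans (Sum-homo (⟪⟫-linear X) ⟦Fin m ⟧ (U ∘ toℕ) (λ k → at (X k) 0))
      (Sum-zero ⟦Fin m ⟧ λ k → 0*-≡ (at (X k) 0) (X⊥U (toℕ k) (Fin.toℕ<n k)))

    KC≡0 : Zero (K C)
    KC≡0 i j = trans (Sum-homo (K-linear i j) ⟦Fin m ⟧ (U ∘ toℕ) (λ k → at (X k) 0))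
      (Sum-zero ⟦Fin m ⟧ λ k → 0*-≡ (at (X k) 0) (comm⇒K-zero (U (toℕ k)) (U-comm (toℕ k)) i j))

    Z : Grid
    Z i j = X i j + X i j - (C i j + Dʳ C i j)

    KZ≡0 : Zero (K Z)
    KZ≡0 i j = begin
      K Z i j
        ≡⟨ -‿homo (K-linear i j) (λ i j → X i j + X i j) (λ i j → C i j + Dʳ C i j) ⟩
      K (λ i j → X i j + X i j) i j - K (λ i j → C i j + Dʳ C i j) i j
        ≡⟨ cong₂ _-_ (trans (+-homo (K-linear i j) X X) (0+-≡ (KX≡0 i j) (KX≡0 i j)))
             (trans (+-homo (K-linear i j) C (Dʳ C)) (0+-≡ (KC≡0 i j)
               (trans (KDʳ C i j) (*0-≡ (sign (toℕ j)) (KC≡0 i j))))) ⟩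
      0ℚ - 0ℚ ≡⟨⟩
      0ℚ ∎

    C-first-column : ∀ i j → toℕ j ≡ 0 → C i j ≡ X i j
    C-first-column i j eq = begin
      C i j
        ≡⟨ Sum-cong ⟦Fin m ⟧ (λ k → cong₂ _*_
             (trans (U-first-column (toℕ k) (ℕ.<⇒≤ (Fin.toℕ<n k)) i j eq) (δ-sym (toℕ i) (toℕ k)))
             (at-toℕ (X k) j eq)) ⟩
      at (λ k → X k j) (toℕ i)
        ≡⟨ at-toℕ (λ k → X k j) i refl ⟩
      X i j ∎

    -- In column 0 both `C` and `C` D agree with X. In column 1 the two cancel, and X D = X forces X
    -- itself to vanish there.
    Z-columns : ∀ i j → toℕ j ≤ 1 → Z i j ≡ 0ℚ
    Z-columns i j j≤1 with ℕ.m≤n⇒m<n∨m≡n j≤1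
    ... | inj₁ (s≤s j≤0) = trans
      (cong₂ (λ s c → X i j + X i j - (c + s * c)) (cong sign (ℕ.n≤0⇒n≡0 j≤0)) (C-first-column i j (ℕ.n≤0⇒n≡0 j≤0)))
      (cancel (X i j))
      where
      cancel : ∀ x → x + x - (x + 1ℚ * x) ≡ 0ℚ
      cancel = solve-∀ ℚ-ring
    ... | inj₂ eq = trans
      (cong₂ (λ x s → x + x - (C i j + s * C i j)) X≡0 (cong sign eq)) (cancel (C i j))
      where
      cancel : ∀ c → 0ℚ + 0ℚ - (c + - 1ℚ * c) ≡ 0ℚ
      cancel = solve-∀ ℚ-ring
      X≡0 : X i j ≡ 0ℚ
      X≡0 = x≡-x⇒x≡0 (trans (sym (DʳX≐X i j)) (trans (cong (λ t → sign t * X i j) eq) (-1* (X i j))))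

    Z≡0 : Zero Z
    Z≡0 = K-kernel-columns Z KZ≡0 Z-columns

  -- Support on the black squares, encoded as D X = X D so that it passes through `K` and through
  -- sums by linearity. `black-Even` and `Even-black` translate.
  Even : Grid → Set
  Even X = D X ≐ Dʳ X

  -- X + D X lives on even columns, and (X - D X) P as well.
  even-K-kernel-orthogonal : ∀ X → Even X → Zero (K X) →
    (∀ k → k ≤ m → ⟪ X , U k ⟫ ≡ 0ℚ) → (∀ k → k ≤ m → ⟪ D X , U k ⟫ ≡ 0ℚ) → Zero X
  even-K-kernel-orthogonal X X-even KX≡0 X⊥U DX⊥U i j = 2x≡0⇒x≡0 (begin
    X i j + X i j          ≡⟨ split (X i j) (D X i j) ⟩
    Y i j + Z i j          ≡⟨ 0+-≡ (Y≡0 i j) (Z≡0 i j) ⟩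
    0ℚ                     ∎)
    where
    open ≡-Reasoning
    split : ∀ x d → x + x ≡ x + d + (x - d)
    split = solve-∀ ℚ-ring

    Y Z : Grid
    Y i j = X i j + D X i j
    Z i j = X i j - D X i j

    KDX≡0 : Zero (K (D X))
    KDX≡0 i j = trans (KD X i j) (*0-≡ (sign (toℕ i)) (KX≡0 i j))

    DʳDX : ∀ i j → Dʳ (D X) i j ≡ X i j
    DʳDX i j = trans (cong (sign (toℕ j) *_) (X-even i j)) (DD (X ᵗ) j i)

    Y≡0 : Zero Y
    Y≡0 = K-kernel-orthogonal Y
      (λ i j → trans (+-homo (K-linear i j) X (D X)) (0+-≡ (KX≡0 i j) (KDX≡0 i j)))
      (λ i j → trans (+-homo (Dʳ-linear i j) X (D X))
        (trans (cong₂ _+_ (sym (X-even i j)) (DʳDX i j)) (ℚ.+-comm (D X i j) (X i j))))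
      (λ k k<m → trans (+-homo (⟪⟫-linearˡ (U k)) X (D X)) (0+-≡ (X⊥U k (ℕ.<⇒≤ k<m)) (DX⊥U k (ℕ.<⇒≤ k<m))))

    KZ≡0 : Zero (K Z)
    KZ≡0 i j = trans (-‿homo (K-linear i j) X (D X)) (cong₂ _-_ (KX≡0 i j) (KDX≡0 i j))

    DʳZ : ∀ i j → Dʳ Z i j ≡ - Z i j
    DʳZ i j = trans (-‿homo (Dʳ-linear i j) X (D X))
      (trans (cong₂ _-_ (sym (X-even i j)) (DʳDX i j)) (flip (D X i j) (X i j)))
      where
      flip : ∀ a b → a - b ≡ - (b - a)
      flip = solve-∀ ℚ-ring

    Z⊥U : ∀ k → k ≤ m → ⟪ Z , U k ⟫ ≡ 0ℚ
    Z⊥U k k≤m = trans (-‿homo (⟪⟫-linearˡ (U k)) X (D X)) (cong₂ _-_ (X⊥U k k≤m) (DX⊥U k k≤m))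

    -- P times `U k` is `U (k + 1)` + `U (k - 1)`; to cover k = m - 1, orthogonality is assumed up
    -- to and including `U m`.
    PʳZ⊥U : ∀ k → k < m → ⟪ Pʳ Z , U k ⟫ ≡ 0ℚ
    PʳZ⊥U k k<m = trans (Pʳ-adjoint Z (U k))
      (trans (≐-cong (⟪⟫-linear Z) (λ i j → sym (U-comm k i j))) (go k k<m))
      where
      go : ∀ k → k < m → ⟪ Z , Pˡ (U k) ⟫ ≡ 0ℚ
      go zero    k<m = Z⊥U 1 k<m
      go (suc k) k<m = trans (≐-cong (⟪⟫-linear Z) (Pˡ-U-suc k))
        (trans (+-homo (⟪⟫-linear Z) (U (suc (suc k))) (U k))
               (0+-≡ (Z⊥U (suc (suc k)) k<m) (Z⊥U k (ℕ.<⇒≤ (ℕ.<⇒≤ k<m)))))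

    PʳZ≡0 : Zero (Pʳ Z)
    PʳZ≡0 = K-kernel-orthogonal (Pʳ Z)
      (λ i j → trans (K-Pʳ Z i j) (0-homo (Pʳ-linear i j) KZ≡0))
      (λ i j → begin
        Dʳ (Pʳ Z) i j                ≡⟨ neg-neg (Dʳ (Pʳ Z) i j) ⟨
        - - Dʳ (Pʳ Z) i j            ≡⟨ cong -_ (PʳDʳ Z i j) ⟨
        - Pʳ (Dʳ Z) i j              ≡⟨ cong -_ (trans (≐-cong (Pʳ-linear i j) DʳZ) (neg-homo (Pʳ-linear i j) Z)) ⟩
        - - Pʳ Z i j                 ≡⟨ neg-neg (Pʳ Z i j) ⟩
        Pʳ Z i j                     ∎)
      PʳZ⊥U

    Z≡0 : Zero Z
    Z≡0 = K-kernel-columns Z KZ≡0 columns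
      where
      -- Right multiplication by D negates Z, so Z vanishes on even columns; its column 1 is the
      -- first column of Z P.
      columns : ∀ i j → toℕ j ≤ 1 → Z i j ≡ 0ℚ
      columns i j j≤1 with ℕ.m≤n⇒m<n∨m≡n j≤1
      ... | inj₁ (s≤s j≤0) = x≡-x⇒x≡0 (trans (sym (trans (cong (λ t → sign t * Z i j) (ℕ.n≤0⇒n≡0 j≤0))
              (ℚ.*-identityˡ (Z i j)))) (DʳZ i j))
      ... | inj₂ eq = let (j₀ , eq₀) = first j in
        trans (sym (at-toℕ (Z i) j eq)) (trans (sym (Pʳ-first Z i j₀ eq₀)) (PʳZ≡0 i j₀))

  -- Against a grid killed by P the recurrence collapses to `U (k + 2)` = - `U k`: this is
  -- evaluation at 0, where the polynomial of degree 2j takes the value (-1)^j.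
  Pˡ-kernel-⟪U⟫ : ∀ X → Zero (Pˡ X) → ∀ j → ⟪ X , U (j ℕ.* 2) ⟫ ≡ sign j * ⟪ X , U 0 ⟫
  Pˡ-kernel-⟪U⟫ X PˡX≡0 zero    = sym (ℚ.*-identityˡ ⟪ X , U 0 ⟫)
  Pˡ-kernel-⟪U⟫ X PˡX≡0 (suc j) = begin
    ⟪ X , U (suc (suc k)) ⟫                 ≡⟨ -‿homo (⟪⟫-linear X) (Pˡ (U (suc k))) (U k) ⟩
    ⟪ X , Pˡ (U (suc k)) ⟫ - ⟪ X , U k ⟫    ≡⟨ cong₂ _-_
      (trans (sym (Pˡ-adjoint X (U (suc k)))) (0-homo (⟪⟫-linearˡ (U (suc k))) PˡX≡0)) (Pˡ-kernel-⟪U⟫ X PˡX≡0 j) ⟩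
    0ℚ - sign j * ⟪ X , U 0 ⟫               ≡⟨ ℚ.+-identityˡ (- (sign j * ⟪ X , U 0 ⟫)) ⟩
    - (sign j * ⟪ X , U 0 ⟫)                ≡⟨ ℚ.neg-distribˡ-* (sign j) ⟪ X , U 0 ⟫ ⟩
    (- sign j) * ⟪ X , U 0 ⟫                ∎
    where
    open ≡-Reasoning
    k = j ℕ.* 2

  -- For even m the path matrix is invertible.
  Pˡ-kernel-orthogonal : ∀ n → m ≡ n ℕ.* 2 → ∀ X → Zero (Pˡ X) → ∀ j → ⟪ X , U (j ℕ.* 2) ⟫ ≡ 0ℚ
  Pˡ-kernel-orthogonal n m≡2n X PˡX≡0 j = trans (Pˡ-kernel-⟪U⟫ X PˡX≡0 j) (*0-≡ (sign j)
    -- The index j = n gives `U m`, which is zero, while its coefficient on ⟪ X , `U 0` ⟫ is ±1.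
    (sign-*-cancel n (trans (sym (Pˡ-kernel-⟪U⟫ X PˡX≡0 n))
      (trans (cong (λ t → ⟪ X , U t ⟫) (sym m≡2n))
      (trans (0-homo (⟪⟫-linear X) U-m-zero) (sym (ℚ.*-zeroʳ (sign n))))))))

-- Vectors on the black squares as even grids.

sign-+ : ∀ i j → sign (i ℕ.+ j) ≡ sign i * sign j
sign-+ zero    j = sym (ℚ.*-identityˡ (sign j))
sign-+ (suc i) j = trans (cong -_ (sign-+ i j)) (ℚ.neg-distribˡ-* (sign i) (sign j))

sign-*2 : ∀ k → sign (k ℕ.* 2) ≡ 1ℚ
sign-*2 zero    = refl
sign-*2 (suc k) = trans (neg-neg (sign (k ℕ.* 2))) (sign-*2 k)

sign-odd : ∀ k → ¬ 2 ∣ k → sign k ≡ - 1ℚ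
sign-odd zero          2∤k = ⊥-elim (2∤k (divides 0 refl))
sign-odd (suc zero)    2∤k = refl
sign-odd (suc (suc k)) 2∤k = trans (neg-neg (sign k)) (sign-odd k (2∤k ∘ ∣m∣n⇒∣m+n ∣-refl))

black⇒sign≡ : ∀ i j → 2 ∣ i ℕ.+ j → sign i ≡ sign j
black⇒sign≡ i j (divides q eq) = sign-*-cancel i (trans (sign*sign i) (sym
  (trans (sym (sign-+ i j)) (trans (cong sign eq) (sign-*2 q)))))

fromMaybe-iverson : ∀ {A : Set} (d : Dec A) → fromMaybe 0ℚ (if does d then just 1ℚ else nothing) ≡ iverson d
fromMaybe-iverson (yes _) = refl
fromMaybe-iverson (no _)  = refl

iverson-× : ∀ {A B : Set} (a : Dec A) (b : Dec B) → iverson (a ×-dec b) ≡ iverson a * iverson b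
iverson-× (yes _) (yes _) = refl
iverson-× (yes _) (no _)  = refl
iverson-× (no _)  b       = sym (ℚ.*-zeroˡ (iverson b))

-- Diagonal neighbours differ by one step in each coordinate, so the matrix is P ⊗ P restricted to
-- the black squares; on grids this becomes X ↦ P X P.
adjacency-MD : ∀ n u v → adjacency (MD n) u v ≡
  step (row (value u)) (row (value v)) * step (col (value u)) (col (value v))
adjacency-MD n u v = trans (fromMaybe-iverson (shareCorner? u v))
  (iverson-× (∣ row (value u) - row (value v) ∣ ℕ.≟ 1) (∣ col (value u) - col (value v) ∣ ℕ.≟ 1))

module Board (m : ℕ) where

  open Grids m
  open LinearForm
  open Chebyshev m

  Even-black : ∀ X → Even X → ∀ i j → ¬ Black (i , j) → X i j ≡ 0ℚ
  Even-black X X-even i j ¬black = x≡-x⇒x≡0 (begin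
    X i j                                           ≡⟨ DD X i j ⟨
    sign (toℕ i) * (sign (toℕ i) * X i j)           ≡⟨ cong (sign (toℕ i) *_) (X-even i j) ⟩
    sign (toℕ i) * (sign (toℕ j) * X i j)           ≡⟨ ℚ.*-assoc (sign (toℕ i)) (sign (toℕ j)) (X i j) ⟨
    sign (toℕ i) * sign (toℕ j) * X i j             ≡⟨ cong (_* X i j) (sign-+ (toℕ i) (toℕ j)) ⟨
    sign (toℕ i ℕ.+ toℕ j) * X i j                  ≡⟨ cong (_* X i j) (sign-odd (toℕ i ℕ.+ toℕ j) ¬black) ⟩
    - 1ℚ * X i j                                    ≡⟨ -1* (X i j) ⟩
    - X i j                                         ∎)
    where
    open ≡-Reasoning

  black-Even : ∀ X → (∀ i j → ¬ Black (i , j) → X i j ≡ 0ℚ) → Even X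
  black-Even X X≡0 i j = go (black? (i , j))
    where
    go : Dec (Black (i , j)) → D X i j ≡ Dʳ X i j
    go (yes b) = cong (_* X i j) (black⇒sign≡ (toℕ i) (toℕ j) b)
    go (no ¬b) = trans (*0-≡ (sign (toℕ i)) (X≡0 i j ¬b)) (sym (*0-≡ (sign (toℕ j)) (X≡0 i j ¬b)))

  Even-Sum : ∀ S (M : Carrier S → Grid) (x : Carrier S → ℚ) → (∀ s → Even (M s)) →
             Even (λ i j → Sum S λ s → M s i j * x s)
  Even-Sum S M x M-even i j = trans (Sum-homo (D-linear i j) S M x)
    (trans (Sum-cong S λ s → cong (_* x s) (M-even s i j)) (sym (Sum-homo (Dʳ-linear i j) S M x)))

  Even-K : ∀ X → Even X → Even (K X)
  Even-K X X-even i j = trans (sym (KD X i j)) (trans (≐-cong (K-linear i j) X-even) (KDʳ X i j))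

  Even-D : ∀ X → Even X → Even (D X)
  Even-D X X-even i j = trans (DD X i j) (sym (trans (cong (sign (toℕ j) *_) (X-even i j)) (DD (X ᵗ) j i)))

  Even-scale : ∀ c X → Even X → Even (λ i j → c * X i j)
  Even-scale c X X-even i j = trans (*-homo (D-linear i j) c X)
    (trans (cong (c *_) (X-even i j)) (sym (*-homo (Dʳ-linear i j) c X)))

  Even-- : ∀ X Y → Even X → Even Y → Even (λ i j → X i j - Y i j)
  Even-- X Y X-even Y-even i j = trans (-‿homo (D-linear i j) X Y)
    (trans (cong₂ _-_ (X-even i j) (Y-even i j)) (sym (-‿homo (Dʳ-linear i j) X Y)))

  Even-ᵗ : ∀ X → Even X → Even (X ᵗ)
  Even-ᵗ X X-even i j = sym (X-even j i)

  Even-PˡPʳ : ∀ X → Even X → Even (Pˡ (Pʳ X))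
  Even-PˡPʳ X X-even i j = begin
    D (Pˡ (Pʳ X)) i j       ≡⟨ neg-neg (D (Pˡ (Pʳ X)) i j) ⟨
    - - D (Pˡ (Pʳ X)) i j   ≡⟨ cong -_ (PˡD (Pʳ X) i j) ⟨
    - Pˡ (D (Pʳ X)) i j     ≡⟨ cong -_ (≐-cong (Pˡ-linear i j) (λ i j →
                                trans (sym (PʳD X i j)) (trans (≐-cong (Pʳ-linear i j) X-even) (PʳDʳ X i j)))) ⟩
    - Pˡ (λ i j → - Dʳ (Pʳ X) i j) i j   ≡⟨ cong -_ (neg-homo (Pˡ-linear i j) (Dʳ (Pʳ X))) ⟩
    - - Pˡ (Dʳ (Pʳ X)) i j  ≡⟨ neg-neg (Pˡ (Dʳ (Pʳ X)) i j) ⟩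
    Pˡ (Dʳ (Pʳ X)) i j      ≡⟨ PˡDʳ (Pʳ X) i j ⟩
    Dʳ (Pˡ (Pʳ X)) i j      ∎
    where open ≡-Reasoning

  Even-U : ∀ k → Even (U (k ℕ.* 2))
  Even-U k i j = trans (D-U (k ℕ.* 2) i j) (1*-≡ (Dʳ (U (k ℕ.* 2)) i j) (sign-*2 k))

  infix 9 _!_
  _!_ : Grid → Carrier (blackSquares m) → ℚ
  X ! v = X (proj₁ (value v)) (proj₂ (value v))

  Even-zero : ∀ X → Even X → (∀ v → X ! v ≡ 0ℚ) → Zero X
  Even-zero X X-even X≡0 i j = go (black? (i , j))
    where
    go : Dec (Black (i , j)) → X i j ≡ 0ℚ
    go (yes b) = X≡0 ((i , j) , [ b ])
    go (no ¬b) = Even-black X X-even i j ¬b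

  extend : (Carrier (blackSquares m) → ℚ) → Grid
  extend y i j with black? (i , j)
  ... | yes b = y ((i , j) , [ b ])
  ... | no _  = 0ℚ

  extend-! : ∀ y v → extend y ! v ≡ y v
  extend-! y ((i , j) , [ b ]) with black? (i , j)
  ... | yes _ = refl
  ... | no ¬b = ⊥-elim (¬b (recompute (black? (i , j)) b))

  extend-¬black : ∀ y i j → ¬ Black (i , j) → extend y i j ≡ 0ℚ
  extend-¬black y i j ¬b with black? (i , j)
  ... | yes b = ⊥-elim (¬b b)
  ... | no _  = refl

  Sum-black : ∀ X → (∀ i j → ¬ Black (i , j) → X i j ≡ 0ℚ) →
    Sum (blackSquares m) (X !_) ≡ Sum ⟦Fin m ⟧ λ i → Sum ⟦Fin m ⟧ λ j → X i j
  Sum-black X X≡0 = trans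
    (Sum-subset (⟦Fin m ⟧ ⊗ ⟦Fin m ⟧) black? (λ s → X (proj₁ s) (proj₂ s)) (λ (i , j) → X≡0 i j))
    (Sum-⊗ ⟦Fin m ⟧ ⟦Fin m ⟧ (λ s → X (proj₁ s) (proj₂ s)))

  Sum-!-* : ∀ X y → Sum (blackSquares m) (λ v → X ! v * y v) ≡ ⟪ X , extend y ⟫
  Sum-!-* X y = trans (Sum-cong (blackSquares m) λ v → cong (X ! v *_) (sym (extend-! y v)))
    (Sum-black (λ i j → X i j * extend y i j) λ i j ¬b → *0-≡ (X i j) (extend-¬black y i j ¬b))

  Sum-step-step : ∀ X → Even X → ∀ i j →
    Sum (blackSquares m) (λ u → step (toℕ i) (row (value u)) * step (toℕ j) (col (value u)) * X ! u) ≡ Pˡ (Pʳ X) i j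
  Sum-step-step X X-even i j = trans
    (Sum-black (λ k l → step (toℕ i) (toℕ k) * step (toℕ j) (toℕ l) * X k l)
      λ k l ¬b → *0-≡ (step (toℕ i) (toℕ k) * step (toℕ j) (toℕ l)) (Even-black X X-even k l ¬b))
    (Sum-cong ⟦Fin m ⟧ λ k → trans
      (Sum-cong ⟦Fin m ⟧ λ l → trans
        (cong₂ (λ a b → a * b * X k l) (step-sym (toℕ i) (toℕ k)) (step-sym (toℕ j) (toℕ l)))
        (ℚ.*-assoc (step (toℕ k) (toℕ i)) (step (toℕ l) (toℕ j)) (X k l)))
      (Sum-*ˡ ⟦Fin m ⟧ (step (toℕ k) (toℕ i)) (λ l → step (toℕ l) (toℕ j) * X k l)))

-- The halved diamond inside the antisymmetric grids.

+-2+ : ∀ a b → a ℕ.+ (2 ℕ.+ b) ≡ 2 ℕ.+ (a ℕ.+ b)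
+-2+ a b = trans (ℕ.+-suc a (suc b)) (cong suc (ℕ.+-suc a b))

odd-∤ : ∀ l → ¬ 2 ∣ suc l ℕ.+ l
odd-∤ zero    (divides (suc q) ())
odd-∤ (suc l) d = odd-∤ l (∣m+n∣m⇒∣n (subst (2 ∣_) (cong (2 ℕ.+_) (ℕ.+-suc l l)) d) ∣-refl)

module Diamond (n′ : ℕ) where

  n m : ℕ
  n = suc n′
  m = 2 ℕ.* n

  m≡n*2 : m ≡ n ℕ.* 2
  m≡n*2 = ℕ.*-comm 2 n

  m≡2+ : m ≡ 2 ℕ.+ 2 ℕ.* n′
  m≡2+ = ℕ.*-suc 2 n′

  open Grids m
  open LinearForm
  open Chebyshev m
  open Board m

  H : FinSet
  H = Graph.vertices (HMD n′)

  rowᴴ colᴴ : Carrier H → ℕ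
  rowᴴ w = row (value (value w))
  colᴴ w = col (value (value w))

  adjᴴ : Carrier H → Carrier H → ℚ
  adjᴴ = adjacency (HMD n′)

  rowᴴ≤colᴴ : ∀ w → rowᴴ w ≤ colᴴ w
  rowᴴ≤colᴴ ((s , _) , [ r≤c ]) = recompute (row s ℕ.≤? col s) r≤c

  blackᴴ : ∀ w → 2 ∣ rowᴴ w ℕ.+ colᴴ w
  blackᴴ ((s , [ b ]) , _) = recompute (black? s) b

  2+colᴴ<m : ∀ w → 2 ℕ.+ colᴴ w < m
  2+colᴴ<m w = subst (2 ℕ.+ colᴴ w <_) (sym m≡2+) (s≤s (s≤s (Fin.toℕ<n (proj₂ (value (value w))))))

  rowᴴ<m : ∀ w → rowᴴ w < m
  rowᴴ<m w = ℕ.≤-<-trans (rowᴴ≤colᴴ w) (ℕ.<-trans (ℕ.m<n+m (colᴴ w) {2} (s≤s z≤n)) (2+colᴴ<m w))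

  -- The vertex (i , j) of the halved diamond sits at (i , j + 2) in the strict
  -- upper triangle.
  F E : Carrier H → Grid
  F w k l = δ (toℕ k) (rowᴴ w) * δ (toℕ l) (2 ℕ.+ colᴴ w)
  E w k l = F w k l - F w l k

  F-zero : ∀ w k l → ¬ (toℕ k ≡ rowᴴ w × toℕ l ≡ 2 ℕ.+ colᴴ w) → F w k l ≡ 0ℚ
  F-zero w k l neq = go (toℕ k ℕ.≟ rowᴴ w) (toℕ l ℕ.≟ 2 ℕ.+ colᴴ w)
    where
    go : Dec (toℕ k ≡ rowᴴ w) → Dec (toℕ l ≡ 2 ℕ.+ colᴴ w) → F w k l ≡ 0ℚ
    go (yes p) (yes q) = ⊥-elim (neq (p , q))
    go (yes p) (no ¬q) = *0-≡ (δ (toℕ k) (rowᴴ w)) (iverson-no (toℕ l ℕ.≟ 2 ℕ.+ colᴴ w) ¬q)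
    go (no ¬p) _       = 0*-≡ (δ (toℕ l) (2 ℕ.+ colᴴ w)) (iverson-no (toℕ k ℕ.≟ rowᴴ w) ¬p)

  F-one : ∀ w k l → toℕ k ≡ rowᴴ w → toℕ l ≡ 2 ℕ.+ colᴴ w → F w k l ≡ 1ℚ
  F-one w k l p q = cong₂ _*_ (iverson-yes (toℕ k ℕ.≟ rowᴴ w) p) (iverson-yes (toℕ l ℕ.≟ 2 ℕ.+ colᴴ w) q)

  F-lower : ∀ w k l → toℕ l ≤ toℕ k → F w k l ≡ 0ℚ
  F-lower w k l l≤k = F-zero w k l λ (p , q) → ℕ.<⇒≱
    (subst₂ _<_ (sym p) (sym q) (ℕ.≤-<-trans (rowᴴ≤colᴴ w) (ℕ.m<n+m (colᴴ w) {2} (s≤s z≤n)))) l≤k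

  Even-F : ∀ w → Even (F w)
  Even-F w = black-Even (F w) λ k l ¬b → F-zero w k l λ (p , q) →
    ¬b (subst (2 ∣_) (sym (trans (cong₂ ℕ._+_ p q) (+-2+ (rowᴴ w) (colᴴ w)))) (∣m∣n⇒∣m+n ∣-refl (blackᴴ w)))

  Even-E : ∀ w → Even (E w)
  Even-E w = Even-- (F w) (F w ᵗ) (Even-F w) (Even-ᵗ (F w) (Even-F w))

  module _ (w : Carrier H) where

    α : ℕ → ℕ → ℚ
    α k l = step (rowᴴ w) k * step (2 ℕ.+ colᴴ w) l

    PˡPʳ-F : ∀ k l → Pˡ (Pʳ (F w)) k l ≡ α (toℕ k) (toℕ l)
    PˡPʳ-F k l = begin
      Sum S (λ i → a i * Sum S (λ j → b j * (c i * d j)))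
        ≡⟨ Sum-cong S (λ i → cong (a i *_) (trans (Sum-cong S λ j → *-left-comm (b j) (c i) (d j))
             (trans (Sum-*ˡ S (c i) (λ j → b j * d j))
                    (cong (c i *_) (step-δ (toℕ l) (2 ℕ.+ colᴴ w) (2+colᴴ<m w)))))) ⟩
      Sum S (λ i → a i * (c i * s))
        ≡⟨ Sum-cong S (λ i → sym (ℚ.*-assoc (a i) (c i) s)) ⟩
      Sum S (λ i → a i * c i * s)
        ≡⟨ Sum-*ʳ S s (λ i → a i * c i) ⟩
      Sum S (λ i → a i * c i) * s
        ≡⟨ cong (_* s) (step-δ (toℕ k) (rowᴴ w) (rowᴴ<m w)) ⟩
      α (toℕ k) (toℕ l) ∎
      where
      open ≡-Reasoning
      S = ⟦Fin m ⟧
      a b c d : Fin m → ℚ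
      a i = step (toℕ i) (toℕ k)
      b j = step (toℕ j) (toℕ l)
      c i = δ (toℕ i) (rowᴴ w)
      d j = δ (toℕ j) (2 ℕ.+ colᴴ w)
      s = step (2 ℕ.+ colᴴ w) (toℕ l)

    PˡPʳ-Fᵗ : ∀ k l → Pˡ (Pʳ (F w ᵗ)) k l ≡ α (toℕ l) (toℕ k)
    PˡPʳ-Fᵗ k l = trans (PˡPʳ-comm (F w ᵗ) k l) (PˡPʳ-F l k)

    step-≤ : ∀ i j → ∣ i - j ∣ ≡ 1 → i ≤ suc j × j ≤ suc i
    step-≤ i j eq = subst (λ t → i ≤ t ℕ.+ j) eq (ℕ.m≤∣m-n∣+n i j) ,
      subst (λ t → j ≤ t ℕ.+ i) (trans (ℕ.∣-∣-comm j i) eq) (ℕ.m≤∣m-n∣+n j i)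

    -- The square of `w` lies at least two columns past the diagonal, so its neighbours lie on or
    -- above the diagonal. On the diagonal `α` can be nonzero, but there the two halves of `E`
    -- cancel; hence no diagonal vertices remain.
    α-lower : ∀ k l → l < k → α k l ≡ 0ℚ
    α-lower k l l<k = go (∣ rowᴴ w - k ∣ ℕ.≟ 1) (∣ 2 ℕ.+ colᴴ w - l ∣ ℕ.≟ 1)
      where
      go : Dec (∣ rowᴴ w - k ∣ ≡ 1) → Dec (∣ 2 ℕ.+ colᴴ w - l ∣ ≡ 1) → α k l ≡ 0ℚ
      go (no ¬p) _       = 0*-≡ (step (2 ℕ.+ colᴴ w) l) (iverson-no (∣ rowᴴ w - k ∣ ℕ.≟ 1) ¬p)
      go (yes _) (no ¬q) = *0-≡ (step (rowᴴ w) k) (iverson-no (∣ 2 ℕ.+ colᴴ w - l ∣ ℕ.≟ 1) ¬q)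
      go (yes p) (yes q) = ⊥-elim (ℕ.<⇒≱ l<k (ℕ.≤-trans (proj₂ (step-≤ (rowᴴ w) k p))
        (ℕ.≤-trans (s≤s (rowᴴ≤colᴴ w)) (ℕ.≤-pred (proj₁ (step-≤ (2 ℕ.+ colᴴ w) l q))))))

    G : Fin m → Fin m → ℚ
    G k l = Sum H λ w′ → F w′ k l * adjᴴ w′ w

    G-lower : ∀ k l → toℕ l ≤ toℕ k → G k l ≡ 0ℚ
    G-lower k l l≤k = Sum-zero H λ w′ → 0*-≡ (adjᴴ w′ w) (F-lower w′ k l l≤k)

  -- By parity a black square strictly above the diagonal is at least two columns past it, so moving
  -- it back by two columns keeps it on or above the diagonal of the smaller board.
  upper-vertex : ∀ k l → toℕ k < toℕ l → Black {m} (k , l) →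
    ∃ λ w₀ → toℕ k ≡ rowᴴ w₀ × toℕ l ≡ 2 ℕ.+ colᴴ w₀
  upper-vertex k l k<l b = go (toℕ k) (toℕ l) k<l (subst (toℕ l <_) m≡2+ (Fin.toℕ<n l)) b
    where
    go : ∀ k l → k < l → l < 2 ℕ.+ 2 ℕ.* n′ → 2 ∣ k ℕ.+ l → ∃ λ w₀ → k ≡ rowᴴ w₀ × l ≡ 2 ℕ.+ colᴴ w₀
    go k (suc zero) (s≤s z≤n) l<m b = ⊥-elim (odd-∤ 0 b)
    go k (suc (suc l)) (s≤s k≤1+l) (s≤s (s≤s l<)) b = w₀ , sym (Fin.toℕ-fromℕ< k<) , cong (2 ℕ.+_) (sym (Fin.toℕ-fromℕ< l<))
      where
      b′ : 2 ∣ k ℕ.+ l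
      b′ = ∣m+n∣m⇒∣n (subst (2 ∣_) (+-2+ k l) b) ∣-refl
      k≢1+l : k ≢ suc l
      k≢1+l refl = odd-∤ l b′
      k≤l : k ≤ l
      k≤l = ℕ.≤-pred (ℕ.≤∧≢⇒< k≤1+l k≢1+l)
      k< : k < 2 ℕ.* n′
      k< = ℕ.≤-<-trans k≤l l<
      w₀ : Carrier H
      w₀ = ((fromℕ< k< , fromℕ< l<) ,
            [ subst (2 ∣_) (sym (cong₂ ℕ._+_ (Fin.toℕ-fromℕ< k<) (Fin.toℕ-fromℕ< l<))) b′ ]) ,
            [ subst₂ _≤_ (sym (Fin.toℕ-fromℕ< k<)) (sym (Fin.toℕ-fromℕ< l<)) k≤l ]

  H-≡ : ∀ w w′ → rowᴴ w ≡ rowᴴ w′ → colᴴ w ≡ colᴴ w′ → w ≡ w′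
  H-≡ w w′ p q = go w w′ (Fin.toℕ-injective p) (Fin.toℕ-injective q)
    where
    go : ∀ (w w′ : Carrier H) → proj₁ (value (value w)) ≡ proj₁ (value (value w′)) →
         proj₂ (value (value w)) ≡ proj₂ (value (value w′)) → w ≡ w′
    go w w′ refl refl = refl

  Sum-F : ∀ w₀ k l → toℕ k ≡ rowᴴ w₀ → toℕ l ≡ 2 ℕ.+ colᴴ w₀ → ∀ (f : Carrier H → ℚ) →
    Sum H (λ w → F w k l * f w) ≡ f w₀
  Sum-F w₀ k l p q f = trans
    (Sum-single H w₀ λ w w≢w₀ → 0*-≡ (f w) (F-zero w k l λ (p′ , q′) →
      w≢w₀ (H-≡ w w₀ (trans (sym p′) p) (ℕ.suc-injective (ℕ.suc-injective (trans (sym q′) q))))))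
    (1*-≡ (f w₀) (F-one w₀ k l p q))

  G-upper : ∀ w k l → toℕ k < toℕ l → Black {m} (k , l) → G w k l ≡ α w (toℕ k) (toℕ l)
  G-upper w k l k<l b =
    let (w₀ , p , q) = upper-vertex k l k<l b in
    trans (Sum-F w₀ k l p q (λ w′ → adjᴴ w′ w))
      (trans (adjacency-MD n′ (value w₀) (value w))
        (cong₂ _*_ (trans (cong (λ t → step t (rowᴴ w)) (sym p)) (step-sym (toℕ k) (rowᴴ w)))
          -- `step` is unchanged by definition when both columns are shifted by two.
          (trans (cong (λ t → step t (2 ℕ.+ colᴴ w)) (sym q)) (step-sym (toℕ l) (2 ℕ.+ colᴴ w)))))

  PˡPʳ-E : ∀ w → Pˡ (Pʳ (E w)) ≐ λ k l → Sum H λ w′ → E w′ k l * adjᴴ w′ w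
  PˡPʳ-E w k l = go (black? (k , l))
    where
    open ≡-Reasoning
    RHS = λ k l → Sum H λ w′ → E w′ k l * adjᴴ w′ w

    RHS-G : RHS k l ≡ G w k l - G w l k
    RHS-G = trans (Sum-cong H λ w′ → ℚ.*-distribʳ-+ (adjᴴ w′ w) (F w′ k l) (- F w′ l k))
      (trans (Sum-+ H (λ w′ → F w′ k l * adjᴴ w′ w) (λ w′ → (- F w′ l k) * adjᴴ w′ w))
        (cong (G w k l +_) (trans (Sum-cong H λ w′ → sym (ℚ.neg-distribˡ-* (F w′ l k) (adjᴴ w′ w)))
                                  (Sum-neg H (λ w′ → F w′ l k * adjᴴ w′ w)))))

    LHS-α : Pˡ (Pʳ (E w)) k l ≡ α w (toℕ k) (toℕ l) - α w (toℕ l) (toℕ k)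
    LHS-α = trans (-‿homo (Pˡ-linear k l ∘ₗ Pʳ-linear) (F w) (F w ᵗ)) (cong₂ _-_ (PˡPʳ-F w k l) (PˡPʳ-Fᵗ w k l))

    α-G : Black {m} (k , l) → α w (toℕ k) (toℕ l) - α w (toℕ l) (toℕ k) ≡ G w k l - G w l k
    α-G b = compare (ℕ.<-cmp (toℕ k) (toℕ l))
      where
      compare : Tri (toℕ k < toℕ l) (toℕ k ≡ toℕ l) (toℕ l < toℕ k) →
                α w (toℕ k) (toℕ l) - α w (toℕ l) (toℕ k) ≡ G w k l - G w l k
      compare (tri< k<l _ _) = cong₂ _-_ (sym (G-upper w k l k<l b))
                             (trans (α-lower w (toℕ l) (toℕ k) k<l) (sym (G-lower w l k (ℕ.<⇒≤ k<l))))
      compare (tri> _ _ l<k) = cong₂ _-_ (trans (α-lower w (toℕ k) (toℕ l) l<k) (sym (G-lower w k l (ℕ.<⇒≤ l<k))))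
                             (sym (G-upper w l k l<k (subst (2 ∣_) (ℕ.+-comm (toℕ k) (toℕ l)) b)))
      compare (tri≈ _ k≡l _) = trans (cong (λ t → α w (toℕ k) t - α w t (toℕ k)) (sym k≡l))
        (trans (ℚ.+-inverseʳ (α w (toℕ k) (toℕ k)))
        (sym (trans (cong (λ t → G w k t - G w t k) (sym (Fin.toℕ-injective k≡l))) (ℚ.+-inverseʳ (G w k k)))))

    go : Dec (Black {m} (k , l)) → Pˡ (Pʳ (E w)) k l ≡ RHS k l
    go (yes b) = trans LHS-α (trans (α-G b) (sym RHS-G))
    go (no ¬b) = trans (Even-black (Pˡ (Pʳ (E w))) (Even-PˡPʳ (E w) (Even-E w)) k l ¬b)
      (sym (Even-black RHS (Even-Sum H E (λ w′ → adjᴴ w′ w) Even-E) k l ¬b))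

  PˡPʳ-KE : ∀ w → Pˡ (Pʳ (K (E w))) ≐ λ k l → Sum H λ w′ → K (E w′) k l * adjᴴ w′ w
  PˡPʳ-KE w k l = trans (sym (K-PˡPʳ (E w) k l))
    (trans (≐-cong (K-linear k l) (PˡPʳ-E w)) (Sum-homo (K-linear k l) H E (λ w′ → adjᴴ w′ w)))

-- The paths with loops, from even Chebyshev polynomials.

module PathColumns (n′ : ℕ) where

  open Diamond n′
  open Grids m
  open LinearForm
  open Chebyshev m
  open Board m

  V : ℕ → Grid
  V j = U (j ℕ.* 2)

  V-n-zero : Zero (V n)
  V-n-zero = subst (Zero ∘ U) m≡n*2 U-m-zero

  PˡPʳ-U : ∀ k → Pˡ (Pʳ (U k)) ≐ Pˡ (Pˡ (U k))
  PˡPʳ-U k i j = ≐-cong (Pˡ-linear i j) λ i j → sym (U-comm k i j)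

  lower : ℕ → Grid
  lower zero    _ _ = 0ℚ
  lower (suc j)     = V j

  -- Applying P U_k = U_(k+1) + U_(k-1) twice returns to `V j` once from above and once from below,
  -- hence the loop 2. From `V 0` there is no way down, hence the loop 1.
  PˡPʳ-V : ∀ j k l → Pˡ (Pʳ (V j)) k l ≡ V (suc j) k l + lower j k l + V j k l * (1ℚ + 1ℚ - δ j 0)
  PˡPʳ-V zero k l = trans (PˡPʳ-U 0 k l) (trans (Pˡ-U-suc 0 k l) (rearrange (V 1 k l) (V 0 k l)))
    where
    rearrange : ∀ a b → a + b ≡ a + 0ℚ + b * (1ℚ + 1ℚ - 1ℚ)
    rearrange = solve-∀ ℚ-ring
  PˡPʳ-V (suc j) k l = begin
    Pˡ (Pʳ (U (suc (suc p)))) k l      ≡⟨ PˡPʳ-U (suc (suc p)) k l ⟩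
    Pˡ (Pˡ (U (suc (suc p)))) k l      ≡⟨ ≐-cong (Pˡ-linear k l) (Pˡ-U-suc (suc p)) ⟩
    Pˡ (λ k l → U (suc (suc (suc p))) k l + U (suc p) k l) k l
      ≡⟨ +-homo (Pˡ-linear k l) (U (suc (suc (suc p)))) (U (suc p)) ⟩
    Pˡ (U (suc (suc (suc p)))) k l + Pˡ (U (suc p)) k l
      ≡⟨ cong₂ _+_ (Pˡ-U-suc (suc (suc p)) k l) (Pˡ-U-suc p k l) ⟩
    V (suc (suc j)) k l + V (suc j) k l + (V (suc j) k l + V j k l)
      ≡⟨ rearrange (V (suc (suc j)) k l) (V (suc j) k l) (V j k l) ⟩
    V (suc (suc j)) k l + V j k l + V (suc j) k l * (1ℚ + 1ℚ - 0ℚ) ∎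
    where
    open ≡-Reasoning
    p = j ℕ.* 2
    rearrange : ∀ a b c → a + b + (b + c) ≡ a + c + b * (1ℚ + 1ℚ - 0ℚ)
    rearrange = solve-∀ ℚ-ring

  loop : Fin n → ℚ
  loop k = 1ℚ + 1ℚ - iverson (isLast? k)

  adjacency-R : ∀ k k′ → adjacency (R n) k k′ ≡ step (toℕ k) (toℕ k′) + 𝟙 ⟦Fin n ⟧ k k′ * loop k
  adjacency-R k k′ = go (FinSet._≟ᶜ_ ⟦Fin n ⟧ k k′) (isLast? k) (∣ toℕ k - toℕ k′ ∣ ℕ.≟ 1)
    where
    go : (d : Dec (k ≡ k′)) (l : Dec (IsLast k)) (s : Dec (∣ toℕ k - toℕ k′ ∣ ≡ 1)) →
      fromMaybe 0ℚ (if does (d ×-dec l) then just 1ℚ else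
                    (if does (d ×-dec U? k) then just (fromℤ (ℤ.+ 2)) else
                     (if does s then just 1ℚ else nothing)))
      ≡ iverson s + iverson d * (1ℚ + 1ℚ - iverson l)
    go (yes refl) _       (yes s) = ⊥-elim (ℕ.0≢1+n (trans (sym (ℕ.∣n-n∣≡0 (toℕ k))) s))
    go (yes refl) (yes _) (no _)  = refl
    go (yes refl) (no _)  (no _)  = refl
    go (no _)     l       (yes s) = sym (+0-≡ (ℚ.*-zeroˡ (1ℚ + 1ℚ - iverson l)) refl)
    go (no _)     l       (no s)  = sym (+0-≡ (ℚ.*-zeroˡ (1ℚ + 1ℚ - iverson l)) refl)

  adjacency-R′ : ∀ k k′ → adjacency (R′ n) k k′ ≡ step (toℕ k) (toℕ k′) + 𝟙 ⟦Fin n ⟧ k k′ * - loop k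
  adjacency-R′ k k′ = go (FinSet._≟ᶜ_ ⟦Fin n ⟧ k k′) (isLast? k) (∣ toℕ k - toℕ k′ ∣ ℕ.≟ 1)
    where
    go : (d : Dec (k ≡ k′)) (l : Dec (IsLast k)) (s : Dec (∣ toℕ k - toℕ k′ ∣ ≡ 1)) →
      fromMaybe 0ℚ (if does (d ×-dec l) then just (- 1ℚ) else
                    (if does (d ×-dec U? k) then just (fromℤ (ℤ.- (ℤ.+ 2))) else
                     (if does s then just 1ℚ else nothing)))
      ≡ iverson s + iverson d * - (1ℚ + 1ℚ - iverson l)
    go (yes refl) _       (yes s) = ⊥-elim (ℕ.0≢1+n (trans (sym (ℕ.∣n-n∣≡0 (toℕ k))) s))
    go (yes refl) (yes _) (no _)  = refl
    go (yes refl) (no _)  (no _)  = refl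
    go (no _)     l       (yes s) = sym (+0-≡ (ℚ.*-zeroˡ (- (1ℚ + 1ℚ - iverson l))) refl)
    go (no _)     l       (no s)  = sym (+0-≡ (ℚ.*-zeroˡ (- (1ℚ + 1ℚ - iverson l))) refl)

  -- Conjugation by alternating signs negates the edges of a path and keeps its loops, so it carries
  -- minus the matrix of `R n` to that of `R′ n`.
  sign-adjacency-R′ : ∀ k k′ → sign (toℕ k) * adjacency (R′ n) k k′ ≡ - (sign (toℕ k′) * adjacency (R n) k k′)
  sign-adjacency-R′ k k′ = begin
    s * adjacency (R′ n) k k′            ≡⟨ cong (s *_) (adjacency-R′ k k′) ⟩
    s * (t + e * - loop k)               ≡⟨ expand s t e (loop k) ⟩
    s * t - s * e * loop k               ≡⟨ cong₂ (λ a b → a - b * loop k) (sign*step (toℕ k) (toℕ k′)) (sign*𝟙 (FinSet._≟ᶜ_ ⟦Fin n ⟧ k k′)) ⟩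
    - (s′ * t) - s′ * e * loop k         ≡⟨ collect s′ t e (loop k) ⟩
    - (s′ * (t + e * loop k))            ≡⟨ cong (λ a → - (s′ * a)) (adjacency-R k k′) ⟨
    - (s′ * adjacency (R n) k k′)        ∎
    where
    open ≡-Reasoning
    s = sign (toℕ k)
    s′ = sign (toℕ k′)
    t = step (toℕ k) (toℕ k′)
    e = 𝟙 ⟦Fin n ⟧ k k′
    sign*𝟙 : Dec (k ≡ k′) → s * e ≡ s′ * e
    sign*𝟙 (yes eq) = cong (λ a → sign (toℕ a) * e) eq
    sign*𝟙 (no neq) = trans (*0-≡ s (𝟙-≢ ⟦Fin n ⟧ neq)) (sym (*0-≡ s′ (𝟙-≢ ⟦Fin n ⟧ neq)))
    expand : ∀ s t e l → s * (t + e * - l) ≡ s * t - s * e * l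
    expand = solve-∀ ℚ-ring
    collect : ∀ s t e l → - (s * t) - s * e * l ≡ - (s * (t + e * l))
    collect = solve-∀ ℚ-ring

  -- The order is reversed because the exceptional loop belongs to `V 0`, while `R n` has it at the
  -- last vertex.
  Vᴿ : Fin n → Grid
  Vᴿ k = V (n′ ℕ.∸ toℕ k)

  module _ (i j : Fin m) where

    x : Fin n → ℚ
    x k = Vᴿ k i j

    at-suc : ∀ p → p ≤ n′ → at x (suc p) ≡ lower (n′ ℕ.∸ p) i j
    at-suc p p≤n′ = go (ℕ.m≤n⇒m<n∨m≡n p≤n′)
      where
      go : p < n′ ⊎ p ≡ n′ → at x (suc p) ≡ lower (n′ ℕ.∸ p) i j
      go (inj₁ p<n′) = trans (at-toℕ x (fromℕ< (s≤s p<n′)) (Fin.toℕ-fromℕ< (s≤s p<n′)))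
        (trans (cong (λ t → V (n′ ℕ.∸ t) i j) (Fin.toℕ-fromℕ< (s≤s p<n′)))
               (cong (λ t → lower t i j) (sym (ℕ.+-∸-assoc 1 p<n′))))
      go (inj₂ refl) = trans (at-≥ x ℕ.≤-refl) (cong (λ t → lower t i j) (sym (ℕ.n∸n≡0 n′)))

    Sum-step-V : ∀ p → p ≤ n′ → Sum ⟦Fin n ⟧ (λ k → step (toℕ k) p * x k) ≡
                 V (suc (n′ ℕ.∸ p)) i j + lower (n′ ℕ.∸ p) i j
    -- The first vertex has one neighbour only. The other term of the recurrence is `V n`, that is
    -- `U m`, which vanishes; this ends the path with an ordinary loop 2.
    Sum-step-V zero    p≤n′ = trans (Sum-step-zero x) (trans (at-suc 0 z≤n) (sym (0+-≡ (V-n-zero i j) refl)))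
    Sum-step-V (suc p) p<n′ = trans (Sum-step-suc x p) (cong₂ _+_
      (trans (at-toℕ x (fromℕ< p<n) (Fin.toℕ-fromℕ< p<n))
        (cong (λ t → V t i j) (trans (cong (n′ ℕ.∸_) (Fin.toℕ-fromℕ< p<n)) (ℕ.+-∸-assoc 1 p<n′))))
      (at-suc (suc p) p<n′))
      where p<n = ℕ.m≤n⇒m≤1+n p<n′

    isLast-δ : ∀ k → iverson (isLast? k) ≡ δ (n′ ℕ.∸ toℕ k) 0
    isLast-δ k = go (isLast? k)
      where
      go : (d : Dec (suc (toℕ k) ≡ n)) → iverson d ≡ δ (n′ ℕ.∸ toℕ k) 0
      go (yes eq) = sym (iverson-yes (n′ ℕ.∸ toℕ k ℕ.≟ 0)
        (trans (cong (n′ ℕ.∸_) (ℕ.suc-injective eq)) (ℕ.n∸n≡0 n′)))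
      go (no neq) = sym (iverson-no (n′ ℕ.∸ toℕ k ℕ.≟ 0) λ eq →
        neq (cong suc (ℕ.≤-antisym (ℕ.≤-pred (Fin.toℕ<n k)) (ℕ.m∸n≡0⇒m≤n eq))))

    PˡPʳ-Vᴿ : ∀ k → Pˡ (Pʳ (Vᴿ k)) i j ≡ Sum ⟦Fin n ⟧ λ k′ → Vᴿ k′ i j * adjacency (R n) k′ k
    PˡPʳ-Vᴿ k = begin
      Pˡ (Pʳ (Vᴿ k)) i j
        ≡⟨ PˡPʳ-V (n′ ℕ.∸ toℕ k) i j ⟩
      V (suc (n′ ℕ.∸ toℕ k)) i j + lower (n′ ℕ.∸ toℕ k) i j + x k * (1ℚ + 1ℚ - δ (n′ ℕ.∸ toℕ k) 0)
        ≡⟨ cong₂ _+_ (Sum-step-V (toℕ k) (ℕ.≤-pred (Fin.toℕ<n k)))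
             (trans (Sum-𝟙ʳ ⟦Fin n ⟧ (λ k′ → x k′ * loop k′) k) (cong (λ t → x k * (1ℚ + 1ℚ - t)) (isLast-δ k))) ⟨
      Sum ⟦Fin n ⟧ (λ k′ → step (toℕ k′) (toℕ k) * x k′) +
      Sum ⟦Fin n ⟧ (λ k′ → 𝟙 ⟦Fin n ⟧ k′ k * (x k′ * loop k′))
        ≡⟨ Sum-+ ⟦Fin n ⟧ (λ k′ → step (toℕ k′) (toℕ k) * x k′) (λ k′ → 𝟙 ⟦Fin n ⟧ k′ k * (x k′ * loop k′)) ⟨
      Sum ⟦Fin n ⟧ (λ k′ → step (toℕ k′) (toℕ k) * x k′ + 𝟙 ⟦Fin n ⟧ k′ k * (x k′ * loop k′))
        ≡⟨ Sum-cong ⟦Fin n ⟧ (λ k′ → trans (collect (x k′) (step (toℕ k′) (toℕ k)) (𝟙 ⟦Fin n ⟧ k′ k) (loop k′))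
             (cong (x k′ *_) (sym (adjacency-R k′ k)))) ⟩
      Sum ⟦Fin n ⟧ (λ k′ → x k′ * adjacency (R n) k′ k) ∎
      where
      open ≡-Reasoning
      collect : ∀ x s e l → s * x + e * (x * l) ≡ x * (s + e * l)
      collect = solve-∀ ℚ-ring

  Vᴿ′ : Fin n → Grid
  Vᴿ′ k i j = sign (toℕ k) * D (Vᴿ k) i j

  PˡPʳ-Vᴿ′ : ∀ k i j → Pˡ (Pʳ (Vᴿ′ k)) i j ≡ Sum ⟦Fin n ⟧ λ k′ → Vᴿ′ k′ i j * adjacency (R′ n) k′ k
  PˡPʳ-Vᴿ′ k i j = begin
    Pˡ (Pʳ (Vᴿ′ k)) i j
      ≡⟨ *-homo (Pˡ-linear i j ∘ₗ Pʳ-linear) s (D (Vᴿ k)) ⟩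
    s * Pˡ (Pʳ (D (Vᴿ k))) i j
      ≡⟨ cong (s *_) (trans (≐-cong (Pˡ-linear i j) (PʳD (Vᴿ k))) (PˡD (Pʳ (Vᴿ k)) i j)) ⟩
    s * - (t * Pˡ (Pʳ (Vᴿ k)) i j)
      ≡⟨ cong (λ a → s * - (t * a)) (PˡPʳ-Vᴿ i j k) ⟩
    s * - (t * Sum ⟦Fin n ⟧ (λ k′ → Vᴿ k′ i j * a k′))
      ≡⟨ assoc s t (Sum ⟦Fin n ⟧ λ k′ → Vᴿ k′ i j * a k′) ⟩
    s * - t * Sum ⟦Fin n ⟧ (λ k′ → Vᴿ k′ i j * a k′)
      ≡⟨ Sum-*ˡ ⟦Fin n ⟧ (s * - t) (λ k′ → Vᴿ k′ i j * a k′) ⟨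
    Sum ⟦Fin n ⟧ (λ k′ → s * - t * (Vᴿ k′ i j * a k′))
      ≡⟨ Sum-cong ⟦Fin n ⟧ (λ k′ → trans (regroup s t (Vᴿ k′ i j) (a k′))
           (trans (cong (t * Vᴿ k′ i j *_) (sym (sign-adjacency-R′ k′ k)))
                  (regroup′ (sign (toℕ k′)) t (Vᴿ k′ i j) (adjacency (R′ n) k′ k)))) ⟩
    Sum ⟦Fin n ⟧ (λ k′ → Vᴿ′ k′ i j * adjacency (R′ n) k′ k) ∎
    where
    open ≡-Reasoning
    s = sign (toℕ k)
    t = sign (toℕ i)
    a : Fin n → ℚ
    a k′ = adjacency (R n) k′ k
    assoc : ∀ s t a → s * - (t * a) ≡ s * - t * a
    assoc = solve-∀ ℚ-ring
    regroup : ∀ s t v a → s * - t * (v * a) ≡ t * v * - (s * a)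
    regroup = solve-∀ ℚ-ring
    regroup′ : ∀ s t v a → t * v * (s * a) ≡ s * (t * v) * a
    regroup′ = solve-∀ ℚ-ring

-- The intertwiner and the injectivity of it and its transpose.

module Intertwiner (n′ : ℕ) where

  open Diamond n′
  open Grids m
  open LinearForm
  open Chebyshev m
  open Board m
  open PathColumns n′

  W : FinSet
  W = Graph.vertices (HMD n′ ∪̇ HMD n′ ∪̇ R n ∪̇ R′ n)

  pattern in₁ w = inj₁ (inj₁ (inj₁ w))
  pattern in₂ w = inj₁ (inj₁ (inj₂ w))
  pattern in₃ k = inj₁ (inj₂ k)
  pattern in₄ k = inj₂ k

  Sum-W : ∀ (f : Carrier W → ℚ) → Sum W f ≡
    Sum H (λ w → f (in₁ w)) + Sum H (λ w → f (in₂ w)) + Sum ⟦Fin n ⟧ (λ k → f (in₃ k)) + Sum ⟦Fin n ⟧ (λ k → f (in₄ k))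
  Sum-W f = trans (Sum-⊕ ((H ⊕ H) ⊕ ⟦Fin n ⟧) ⟦Fin n ⟧ f) (cong (_+ Sum ⟦Fin n ⟧ (λ k → f (in₄ k)))
    (trans (Sum-⊕ (H ⊕ H) ⟦Fin n ⟧ (f ∘ inj₁)) (cong (_+ Sum ⟦Fin n ⟧ (λ k → f (in₃ k)))
      (Sum-⊕ H H (f ∘ inj₁ ∘ inj₁)))))

  column : Carrier W → Grid
  column (in₁ w) = E w
  column (in₂ w) = K (E w)
  column (in₃ k) = Vᴿ k
  column (in₄ k) = Vᴿ′ k

  Even-Vᴿ : ∀ k → Even (Vᴿ k)
  Even-Vᴿ k = Even-U (n′ ℕ.∸ toℕ k)

  Even-column : ∀ w → Even (column w)
  Even-column (in₁ w) = Even-E w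
  Even-column (in₂ w) = Even-K (E w) (Even-E w)
  Even-column (in₃ k) = Even-Vᴿ k
  Even-column (in₄ k) = Even-scale (sign (toℕ k)) (D (Vᴿ k)) (Even-D (Vᴿ k) (Even-Vᴿ k))

  adjᵂ : Matrix W W
  adjᵂ = adjacency (HMD n′ ∪̇ HMD n′ ∪̇ R n ∪̇ R′ n)

  PˡPʳ-column : ∀ w i j → Pˡ (Pʳ (column w)) i j ≡ Sum W λ w′ → column w′ i j * adjᵂ w′ w
  PˡPʳ-column w i j = trans (go w) (sym (Sum-W λ w′ → column w′ i j * adjᵂ w′ w))
    where
    H-zero : ∀ (M : Carrier H → ℚ) → Sum H (λ w → M w * 0ℚ) ≡ 0ℚ
    H-zero M = Sum-zero H λ w → ℚ.*-zeroʳ (M w)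
    Fin-zero : ∀ (M : Fin n → ℚ) → Sum ⟦Fin n ⟧ (λ w → M w * 0ℚ) ≡ 0ℚ
    Fin-zero M = Sum-zero ⟦Fin n ⟧ λ w → ℚ.*-zeroʳ (M w)
    z₁ = H-zero λ w → E w i j
    z₂ = H-zero λ w → K (E w) i j
    z₃ = Fin-zero λ k → Vᴿ k i j
    z₄ = Fin-zero λ k → Vᴿ′ k i j
    go : ∀ w → Pˡ (Pʳ (column w)) i j ≡
      Sum H (λ w′ → E w′ i j * adjᵂ (in₁ w′) w) + Sum H (λ w′ → K (E w′) i j * adjᵂ (in₂ w′) w) +
      Sum ⟦Fin n ⟧ (λ k → Vᴿ k i j * adjᵂ (in₃ k) w) + Sum ⟦Fin n ⟧ (λ k → Vᴿ′ k i j * adjᵂ (in₄ k) w)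
    go (in₁ w) = sym (+0-≡ z₄ (+0-≡ z₃ (+0-≡ z₂ (sym (PˡPʳ-E w i j)))))
    go (in₂ w) = sym (+0-≡ z₄ (+0-≡ z₃ (0+-≡ z₁ (sym (PˡPʳ-KE w i j)))))
    go (in₃ k) = sym (+0-≡ z₄ (0+-≡ (0+-≡ z₁ z₂) (sym (PˡPʳ-Vᴿ i j k))))
    go (in₄ k) = sym (0+-≡ (0+-≡ (0+-≡ z₁ z₂) z₃) (sym (PˡPʳ-Vᴿ′ k i j)))

  Black-squares : FinSet
  Black-squares = blackSquares m

  T : Matrix Black-squares W
  T v w = column w ! v

  T-intertwines : mul Black-squares Black-squares W (adjacency (MD n)) T ≐ mul Black-squares W W T adjᵂ
  T-intertwines v w = trans (Sum-cong Black-squares λ u → cong (_* column w ! u) (adjacency-MD n v u))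
    (trans (Sum-step-step (column w) (Even-column w) (proj₁ (value v)) (proj₂ (value v)))
           (PˡPʳ-column w (proj₁ (value v)) (proj₂ (value v))))

  ⟪F⟫ : ∀ w k l → toℕ k ≡ rowᴴ w → toℕ l ≡ 2 ℕ.+ colᴴ w → ∀ Y → ⟪ F w , Y ⟫ ≡ Y k l
  ⟪F⟫ w k l p q Y = trans
    (Sum-single ⟦Fin m ⟧ k λ i i≢k → Sum-zero ⟦Fin m ⟧ λ j → 0*-≡ (Y i j)
      (F-zero w i j λ (p′ , _) → i≢k (Fin.toℕ-injective (trans p′ (sym p)))))
    (trans (Sum-single ⟦Fin m ⟧ l λ j j≢l → 0*-≡ (Y k j)
      (F-zero w k j λ (_ , q′) → j≢l (Fin.toℕ-injective (trans q′ (sym q)))))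
      (1*-≡ (Y k l) (F-one w k l p q)))

  -- Pairing with `E w` reads off the difference of two mirror entries, and `upper-vertex` reaches
  -- every black square above the diagonal in this way.
  E-orthogonal⇒symmetric : ∀ Y → Even Y → (∀ w → ⟪ E w , Y ⟫ ≡ 0ℚ) → ∀ k l → Y k l ≡ Y l k
  E-orthogonal⇒symmetric Y Y-even E⊥Y k l = go (black? (k , l)) (ℕ.<-cmp (toℕ k) (toℕ l))
    where
    upper : ∀ k l → toℕ k < toℕ l → Black {m} (k , l) → Y k l ≡ Y l k
    upper k l k<l b =
      let (w , p , q) = upper-vertex k l k<l b in
      a-b≡0⇒a≡b (Y k l) (Y l k) (trans
        (sym (cong₂ _-_ (⟪F⟫ w k l p q Y) (trans (⟪⟫-ᵗ (F w) (Y ᵗ)) (⟪F⟫ w k l p q (Y ᵗ)))))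
        (trans (sym (-‿homo (⟪⟫-linearˡ Y) (F w) (F w ᵗ))) (E⊥Y w)))
    black-comm : Black {m} (k , l) → Black {m} (l , k)
    black-comm = subst (2 ∣_) (ℕ.+-comm (toℕ k) (toℕ l))
    black-comm′ : Black {m} (l , k) → Black {m} (k , l)
    black-comm′ = subst (2 ∣_) (ℕ.+-comm (toℕ l) (toℕ k))
    go : Dec (Black {m} (k , l)) → Tri (toℕ k < toℕ l) (toℕ k ≡ toℕ l) (toℕ l < toℕ k) → Y k l ≡ Y l k
    go (no ¬b) _              = trans (Even-black Y Y-even k l ¬b) (sym (Even-black Y Y-even l k (¬b ∘ black-comm′)))
    go (yes b) (tri< k<l _ _) = upper k l k<l b
    go (yes b) (tri≈ _ k≡l _) = cong₂ Y (Fin.toℕ-injective k≡l) (sym (Fin.toℕ-injective k≡l))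
    go (yes b) (tri> _ _ l<k) = sym (upper l k l<k (black-comm b))

  -- The supports are disjoint: inserting D on both sides of the pairing leaves it unchanged, yet by
  -- `D-U` negates it. This supplies the odd indices, which are absent among the columns.
  ⟪Even,U-odd⟫ : ∀ X → Even X → ∀ k → ¬ 2 ∣ k → ⟪ X , U k ⟫ ≡ 0ℚ
  ⟪Even,U-odd⟫ X X-even k 2∤k = x≡-x⇒x≡0 (begin
    ⟪ X , U k ⟫                                ≡⟨ ≐-cong (⟪⟫-linear X) (DD (U k)) ⟨
    ⟪ X , D (D (U k)) ⟫                        ≡⟨ D-adjoint X (D (U k)) ⟨
    ⟪ D X , D (U k) ⟫                          ≡⟨ ≐-cong (⟪⟫-linear (D X)) (D-U k) ⟩
    ⟪ D X , (λ i j → sign k * Dʳ (U k) i j) ⟫  ≡⟨ *-homo (⟪⟫-linear (D X)) (sign k) (Dʳ (U k)) ⟩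
    sign k * ⟪ D X , Dʳ (U k) ⟫                ≡⟨ cong₂ _*_ (sign-odd k 2∤k)
      (trans (≐-cong (⟪⟫-linearˡ (Dʳ (U k))) X-even)
        (trans (Dʳ-adjoint X (Dʳ (U k))) (≐-cong (⟪⟫-linear X) λ i j → DD (U k ᵗ) j i))) ⟩
    - 1ℚ * ⟪ X , U k ⟫                         ≡⟨ -1* ⟪ X , U k ⟫ ⟩
    - ⟪ X , U k ⟫                              ∎)
    where
    open ≡-Reasoning

  Vᴿ-orthogonal⇒U-orthogonal : ∀ X → Even X → (∀ k → ⟪ X , Vᴿ k ⟫ ≡ 0ℚ) → ∀ k → k ≤ m → ⟪ X , U k ⟫ ≡ 0ℚ
  Vᴿ-orthogonal⇒U-orthogonal X X-even X⊥V k k≤m = go (2 ∣? k)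
    where
    even : ∀ q → q < n ⊎ q ≡ n → ⟪ X , V q ⟫ ≡ 0ℚ
    even q (inj₁ q<n) = trans (cong (λ t → ⟪ X , V t ⟫)
        (trans (sym (ℕ.m∸[m∸n]≡n (ℕ.≤-pred q<n))) (cong (n′ ℕ.∸_) (sym (Fin.toℕ-fromℕ< n′-q<n)))))
      (X⊥V (fromℕ< n′-q<n))
      where
      n′-q<n : n′ ℕ.∸ q < n
      n′-q<n = s≤s (ℕ.m∸n≤m n′ q)
    even q (inj₂ refl) = 0-homo (⟪⟫-linear X) V-n-zero
    go : Dec (2 ∣ k) → ⟪ X , U k ⟫ ≡ 0ℚ
    go (yes (divides q eq)) = trans (cong (λ t → ⟪ X , U t ⟫) eq)
      (even q (ℕ.m≤n⇒m<n∨m≡n (ℕ.*-cancelʳ-≤ q n 2 (subst₂ _≤_ eq m≡n*2 k≤m))))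
    go (no 2∤k) = ⟪Even,U-odd⟫ X X-even k 2∤k

  -- Orthogonality to the `E w` makes `Y` symmetric, so `K Y` is antisymmetric. Orthogonality to the
  -- `K (E w)`, moved across by self-adjointness, makes `K Y` symmetric too, hence zero. The path
  -- columns then exclude a nonzero element of the kernel of `K`.
  Tᵗ-injective : Injective W Black-squares (λ w v → T v w)
  Tᵗ-injective y Ty≡0 v = trans (sym (extend-! y v)) (Y≡0 (proj₁ (value v)) (proj₂ (value v)))
    where
    Y : Grid
    Y = extend y
    Y-even : Even Y
    Y-even = black-Even Y (extend-¬black y)
    Y⊥ : ∀ w → ⟪ column w , Y ⟫ ≡ 0ℚ
    Y⊥ w = trans (sym (Sum-!-* (column w) y)) (Ty≡0 w)
    Y-sym : ∀ k l → Y k l ≡ Y l k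
    Y-sym = E-orthogonal⇒symmetric Y Y-even λ w → Y⊥ (in₁ w)
    KY-sym : ∀ k l → K Y k l ≡ K Y l k
    KY-sym = E-orthogonal⇒symmetric (K Y) (Even-K Y Y-even)
      λ w → trans (sym (K-adjoint (E w) Y)) (Y⊥ (in₂ w))
    KY≡0 : Zero (K Y)
    KY≡0 k l = x≡-x⇒x≡0 (trans (≐-cong (K-linear k l) Y-sym) (trans (K-ᵗ Y k l) (cong -_ (KY-sym l k))))
    DY⊥V : ∀ k → ⟪ D Y , Vᴿ k ⟫ ≡ 0ℚ
    DY⊥V k = sign-*-cancel (toℕ k) (trans (cong (sign (toℕ k) *_) (trans (⟪⟫-sym (D Y) (Vᴿ k)) (sym (D-adjoint (Vᴿ k) Y))))
      (trans (sym (*-homo (⟪⟫-linearˡ Y) (sign (toℕ k)) (D (Vᴿ k)))) (trans (Y⊥ (in₄ k)) (sym (ℚ.*-zeroʳ (sign (toℕ k)))))))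
    Y≡0 : Zero Y
    Y≡0 = even-K-kernel-orthogonal Y Y-even KY≡0
      (Vᴿ-orthogonal⇒U-orthogonal Y Y-even λ k → trans (⟪⟫-sym Y (Vᴿ k)) (Y⊥ (in₃ k)))
      (Vᴿ-orthogonal⇒U-orthogonal (D Y) (Even-D Y Y-even) DY⊥V)

  ⟪antisymmetric,U⟫ : ∀ X → (∀ i j → X j i ≡ - X i j) → ∀ k → ⟪ X , U k ⟫ ≡ 0ℚ
  ⟪antisymmetric,U⟫ X X-anti k = x≡-x⇒x≡0 (begin
    ⟪ X , U k ⟫                  ≡⟨ ⟪⟫-ᵗ X (U k) ⟨
    ⟪ X ᵗ , U k ᵗ ⟫              ≡⟨ ≐-cong (⟪⟫-linear (X ᵗ)) (U-sym k) ⟨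
    ⟪ X ᵗ , U k ⟫                ≡⟨ ≐-cong (⟪⟫-linearˡ (U k)) X-anti ⟩
    ⟪ (λ i j → - X i j) , U k ⟫  ≡⟨ neg-homo (⟪⟫-linearˡ (U k)) X ⟩
    - ⟪ X , U k ⟫                ∎)
    where open ≡-Reasoning

  combE : (Carrier H → ℚ) → Grid
  combE x i j = Sum H λ w → E w i j * x w

  combE-antisymmetric : ∀ x i j → combE x j i ≡ - combE x i j
  combE-antisymmetric x i j = trans (Sum-cong H λ w → flip (F w j i) (F w i j) (x w)) (Sum-neg H λ w → E w i j * x w)
    where
    flip : ∀ a b c → (a - b) * c ≡ - ((b - a) * c)
    flip = solve-∀ ℚ-ring

  Even-combE : ∀ x → Even (combE x)
  Even-combE x = Even-Sum H E x Even-E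

  combE-injective : ∀ x → Zero (combE x) → ∀ w → x w ≡ 0ℚ
  combE-injective x combE≡0 w = begin
    x w                           ≡⟨ Sum-F w k l p q x ⟨
    Sum H (λ w′ → F w′ k l * x w′) ≡⟨ Sum-cong H (λ w′ → cong (_* x w′)
      (sym (+0-≡ {F w′ k l} (cong -_ (F-lower w′ l k k≤l)) refl))) ⟩
    combE x k l                   ≡⟨ combE≡0 k l ⟩
    0ℚ                            ∎
    where
    open ≡-Reasoning
    k l : Fin m
    k = fromℕ< (rowᴴ<m w)
    l = fromℕ< (2+colᴴ<m w)
    p : toℕ k ≡ rowᴴ w
    p = Fin.toℕ-fromℕ< (rowᴴ<m w)
    q : toℕ l ≡ 2 ℕ.+ colᴴ w
    q = Fin.toℕ-fromℕ< (2+colᴴ<m w)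
    k≤l : toℕ k ≤ toℕ l
    k≤l = subst₂ _≤_ (sym p) (sym q) (ℕ.≤-trans (rowᴴ≤colᴴ w) (ℕ.m≤n+m (colᴴ w) 2))

  combV : (Fin n → ℚ) → Grid
  combV c i j = Sum ⟦Fin n ⟧ λ k → Vᴿ k i j * c k

  Even-combV : ∀ c → Even (combV c)
  Even-combV c = Even-Sum ⟦Fin n ⟧ Vᴿ c Even-Vᴿ

  combV-sym : ∀ c i j → combV c i j ≡ combV c j i
  combV-sym c i j = Sum-cong ⟦Fin n ⟧ λ k → cong (_* c k) (U-sym ((n′ ℕ.∸ toℕ k) ℕ.* 2) i j)

  combV-comm : ∀ c → Pˡ (combV c) ≐ Pʳ (combV c)
  combV-comm c i j = trans (Sum-homo (Pˡ-linear i j) ⟦Fin n ⟧ Vᴿ c)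
    (trans (Sum-cong ⟦Fin n ⟧ λ k → cong (_* c k) (U-comm ((n′ ℕ.∸ toℕ k) ℕ.* 2) i j))
           (sym (Sum-homo (Pʳ-linear i j) ⟦Fin n ⟧ Vᴿ c)))

  -- By `U-first-column` the coefficients stand in the first column of the combination, each in its
  -- own row `index k`.
  combV-injective : ∀ c → Zero (combV c) → ∀ k → c k ≡ 0ℚ
  combV-injective c combV≡0 k = begin
    c k                                                  ≡⟨ 1*-≡ (c k) (iverson-yes (toℕ i ℕ.≟ index k) i≡) ⟨
    δ (toℕ i) (index k) * c k                            ≡⟨ Sum-single ⟦Fin n ⟧ k (λ k′ k′≢k → 0*-≡ (c k′)
      (iverson-no (toℕ i ℕ.≟ index k′) (λ eq → k′≢k (index-injective k′ k (trans (sym eq) i≡))))) ⟨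
    Sum ⟦Fin n ⟧ (λ k′ → δ (toℕ i) (index k′) * c k′)    ≡⟨ Sum-cong ⟦Fin n ⟧ (λ k′ →
      cong (_* c k′) (sym (U-first-column (index k′) (ℕ.<⇒≤ (index< k′)) i zero refl))) ⟩
    combV c i zero                                       ≡⟨ combV≡0 i zero ⟩
    0ℚ                                                   ∎
    where
    open ≡-Reasoning
    index : Fin n → ℕ
    index k = (n′ ℕ.∸ toℕ k) ℕ.* 2
    index< : ∀ k → index k < m
    index< k = subst (index k <_) (sym m≡n*2) (ℕ.*-monoˡ-< 2 (s≤s (ℕ.m∸n≤m n′ (toℕ k))))
    index-injective : ∀ k k′ → index k ≡ index k′ → k ≡ k′
    index-injective k k′ eq = Fin.toℕ-injective (ℕ.∸-cancelˡ-≡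
      (ℕ.≤-pred (Fin.toℕ<n k)) (ℕ.≤-pred (Fin.toℕ<n k′)) (ℕ.*-cancelʳ-≡ (n′ ℕ.∸ toℕ k) (n′ ℕ.∸ toℕ k′) 2 eq))
    i : Fin m
    i = fromℕ< (index< k)
    i≡ : toℕ i ≡ index k
    i≡ = Fin.toℕ-fromℕ< (index< k)

  -- A combination killed by P is orthogonal to every `V j`, hence to itself.
  combV-Pˡ-injective : ∀ c → Zero (Pˡ (combV c)) → ∀ k → c k ≡ 0ℚ
  combV-Pˡ-injective c Pˡ≡0 = combV-injective c (⟪⟫-definite (combV c)
    (trans (Sum-homo (⟪⟫-linear (combV c)) ⟦Fin n ⟧ Vᴿ c)
      (Sum-zero ⟦Fin n ⟧ λ k → 0*-≡ (c k) (Pˡ-kernel-orthogonal n m≡n*2 (combV c) Pˡ≡0 (n′ ℕ.∸ toℕ k)))))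

  -- The parts of a kernel vector are separated by symmetry and orthogonality: `G₁` is antisymmetric
  -- and `S` symmetric; `K G₂` is orthogonal to `N`, as `K` is self-adjoint and kills `N`; and `G₂`,
  -- once in the kernel of `K`, is antisymmetric along with D `G₂`, so both are orthogonal to all
  -- `U k`.
  T-injective : Injective Black-squares W T
  T-injective x Tx≡0 = λ
    { (in₁ w) → combE-injective x₁ G₁≡0 w
    ; (in₂ w) → combE-injective x₂ G₂≡0 w
    ; (in₃ k) → combV-Pˡ-injective x₃ PˡA≡0 k
    ; (in₄ k) → sign-*-cancel (toℕ k) (trans (combV-Pˡ-injective x₄ PˡB≡0 k) (sym (ℚ.*-zeroʳ (sign (toℕ k)))))
    }
    where
    open ≡-Reasoning
    x₁ x₂ : Carrier H → ℚ
    x₁ w = x (in₁ w)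
    x₂ w = x (in₂ w)
    x₃ x₄ : Fin n → ℚ
    x₃ k = x (in₃ k)
    x₄ k = sign (toℕ k) * x (in₄ k)
    G₁ G₂ A B S N : Grid
    G₁ = combE x₁
    G₂ = combE x₂
    A = combV x₃
    B = combV x₄
    N i j = A i j + D B i j
    S i j = K G₂ i j + N i j

    total : ∀ i j → Sum W (λ w → column w i j * x w) ≡ G₁ i j + S i j
    total i j = trans (Sum-W λ w → column w i j * x w) (trans
      (cong₂ (λ a b → G₁ i j + a + A i j + b)
        (sym (Sum-homo (K-linear i j) H E x₂))
        (trans (Sum-cong ⟦Fin n ⟧ λ k → regroup (sign (toℕ k)) (D (Vᴿ k) i j) (x (in₄ k)))
          (sym (Sum-homo (D-linear i j) ⟦Fin n ⟧ Vᴿ x₄))))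
      (assoc (G₁ i j) (K G₂ i j) (A i j) (D B i j)))
      where
      regroup : ∀ s d x → s * d * x ≡ d * (s * x)
      regroup = solve-∀ ℚ-ring
      assoc : ∀ a b c d → a + b + c + d ≡ a + (b + (c + d))
      assoc = solve-∀ ℚ-ring

    G₁+S≡0 : ∀ i j → G₁ i j + S i j ≡ 0ℚ
    G₁+S≡0 i j = trans (sym (total i j))
      (Even-zero (λ i j → Sum W λ w → column w i j * x w) (Even-Sum W column x Even-column) Tx≡0 i j)

    DB-sym : ∀ i j → D B j i ≡ D B i j
    DB-sym i j = trans (cong (sign (toℕ j) *_) (combV-sym x₄ j i)) (sym (Even-combV x₄ i j))

    KG₂-sym : ∀ i j → K G₂ j i ≡ K G₂ i j
    KG₂-sym i j = begin
      K G₂ j i                        ≡⟨ neg-neg (K G₂ j i) ⟨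
      - - K G₂ j i                    ≡⟨ cong -_ (K-ᵗ G₂ i j) ⟨
      - K (G₂ ᵗ) i j                  ≡⟨ cong -_ (≐-cong (K-linear i j) (combE-antisymmetric x₂)) ⟩
      - K (λ i j → - G₂ i j) i j      ≡⟨ cong -_ (neg-homo (K-linear i j) G₂) ⟩
      - - K G₂ i j                    ≡⟨ neg-neg (K G₂ i j) ⟩
      K G₂ i j                        ∎

    S-sym : ∀ i j → S j i ≡ S i j
    S-sym i j = cong₂ _+_ (KG₂-sym i j) (cong₂ _+_ (combV-sym x₃ j i) (DB-sym i j))

    G₁≡0 : Zero G₁
    G₁≡0 i j = 2x≡0⇒x≡0 (trans (split (G₁ i j) (S i j)) (cong₂ _-_ (G₁+S≡0 i j)
      (trans (cong₂ _+_ (sym (combE-antisymmetric x₁ i j)) (sym (S-sym i j))) (G₁+S≡0 j i))))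
      where
      split : ∀ g s → g + g ≡ g + s - (- g + s)
      split = solve-∀ ℚ-ring

    S≡0 : Zero S
    S≡0 i j = trans (sym (0+-≡ (G₁≡0 i j) refl)) (G₁+S≡0 i j)

    KN≡0 : Zero (K N)
    KN≡0 i j = trans (+-homo (K-linear i j) A (D B)) (0+-≡ (comm⇒K-zero A (combV-comm x₃) i j)
      (trans (KD B i j) (*0-≡ (sign (toℕ i)) (comm⇒K-zero B (combV-comm x₄) i j))))

    N≡0 : Zero N
    N≡0 = ⟪⟫-definite N (begin
      ⟪ N , N ⟫                      ≡⟨ insert ⟪ K G₂ , N ⟫ ⟪ N , N ⟫ ⟩
      ⟪ K G₂ , N ⟫ + ⟪ N , N ⟫ - ⟪ K G₂ , N ⟫
        ≡⟨ cong₂ _-_ (trans (sym (+-homo (⟪⟫-linearˡ N) (K G₂) N)) (0-homo (⟪⟫-linearˡ N) S≡0))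
                     (trans (K-adjoint G₂ N) (0-homo (⟪⟫-linear G₂) KN≡0)) ⟩
      0ℚ - 0ℚ                        ≡⟨⟩
      0ℚ                             ∎)
      where
      insert : ∀ a b → b ≡ a + b - a
      insert = solve-∀ ℚ-ring

    KG₂≡0 : Zero (K G₂)
    KG₂≡0 i j = trans (sym (+0-≡ (N≡0 i j) refl)) (S≡0 i j)

    G₂≡0 : Zero G₂
    G₂≡0 = even-K-kernel-orthogonal G₂ (Even-combE x₂) KG₂≡0
      (λ k _ → ⟪antisymmetric,U⟫ G₂ (combE-antisymmetric x₂) k)
      (λ k _ → ⟪antisymmetric,U⟫ (D G₂) DG₂-anti k)
      where
      DG₂-anti : ∀ i j → D G₂ j i ≡ - D G₂ i j
      DG₂-anti i j = begin
        sign (toℕ j) * G₂ j i          ≡⟨ cong (sign (toℕ j) *_) (combE-antisymmetric x₂ i j) ⟩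
        sign (toℕ j) * - G₂ i j        ≡⟨ ℚ.neg-distribʳ-* (sign (toℕ j)) (G₂ i j) ⟨
        - (sign (toℕ j) * G₂ i j)      ≡⟨ cong -_ (Even-combE x₂ i j) ⟨
        - D G₂ i j                     ∎

    A≡-DB : ∀ i j → A i j ≡ - D B i j
    A≡-DB i j = trans (insert (A i j) (D B i j)) (0+-≡ (N≡0 i j) refl)
      where
      insert : ∀ a b → a ≡ a + b + - b
      insert = solve-∀ ℚ-ring

    -- `A` commutes with P whereas D `B` anticommutes with it, so `A` = - D `B` yields P `A` = - P
    -- `A`. Thus P kills `A` and then `B`, and its invertibility finishes the argument.
    PˡA≡DPˡB : ∀ i j → Pˡ A i j ≡ D (Pˡ B) i j
    PˡA≡DPˡB i j = trans (≐-cong (Pˡ-linear i j) A≡-DB) (trans (neg-homo (Pˡ-linear i j) (D B))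
      (trans (cong -_ (PˡD B i j)) (neg-neg (D (Pˡ B) i j))))

    PʳA≡-DPˡB : ∀ i j → Pʳ A i j ≡ - D (Pˡ B) i j
    PʳA≡-DPˡB i j = trans (≐-cong (Pʳ-linear i j) A≡-DB) (trans (neg-homo (Pʳ-linear i j) (D B))
      (cong -_ (trans (PʳD B i j) (cong (sign (toℕ i) *_) (sym (combV-comm x₄ i j))))))

    PˡA≡0 : Zero (Pˡ A)
    PˡA≡0 i j = x≡-x⇒x≡0 (trans (combV-comm x₃ i j) (trans (PʳA≡-DPˡB i j) (cong -_ (sym (PˡA≡DPˡB i j)))))

    PˡB≡0 : Zero (Pˡ B)
    PˡB≡0 i j = sign-*-cancel (toℕ i) (trans (sym (PˡA≡DPˡB i j)) (trans (PˡA≡0 i j) (sym (ℚ.*-zeroʳ (sign (toℕ i))))))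

theorem3p1 : (n : ℕ) → 1 ≤ n → MD n ∼ HMD (n ∸ 1) ∪̇ HMD (n ∸ 1) ∪̇ R n ∪̇ R′ n
theorem3p1 (suc n′) _ = similar-intertwined Black-squares W (adjacency (MD (suc n′))) adjᵂ T
  T-intertwines T-injective Tᵗ-injective
  where open Intertwiner n′
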